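{- Let $G$ and $H$ be connected ribbon graphs. (1) If $G$ and $H$ are both plane, then they are partial duals of each other if and only if they are related by dualling join-summands. (2) If $G$ and $H$ are both $\mathbb{R}\mathrm{P}^2$, then they are partial duals of each other if and only if they are related by dualling join-summands.
   Context: A ribbon graph is a surface with boundary made of vertex discs and edge discs meeting in disjoint segments, each segment on the boundary of exactly one vertex and one edge, each edge containing exactly two segments; considered up to homeomorphism. Euler genus $\gamma$: twice the genus if orientable, non-orientable genus otherwise. Plane (resp. $\mathbb{R}\mathrm{P}^2$) ribbon graph: connected with $\gamma=0$ (resp. $\gamma=1$). Partial dual $G^A$ ($A\subseteq E(G)$): orient each edge boundary arbitrarily; the boundary components of the spanning ribbon subgraph $(V(G),A)$ meet the edges of $G$ in disjoint arcs; mark each such arc with an arrow in the direction of the edge's boundary orientation, labelled by the edge; $G^A$ is obtained by capping each marked boundary component with a vertex disc and, for each label $e$, attaching an edge disc along the two $e$-labelled arrows respecting directions. $G^{E(G)}=G^*$ is the geometric dual. $G$ and $H$ are partial duals of each other if $H=G^A$ for some $A\subseteq E(G)$. Join: for connected $G$ with non-trivial connected ribbon subgraphs $P,Q$, $G=P\cup Q$, $P\cap Q=\{v\}$, and an arc on the boundary of $v$ met by all edges of $P$ incident to $v$ and by no edges of $Q$, write $G=P\vee Q$. If $G=P\vee Q$, the ribbon graph $G^{E(Q)}=P\vee Q^*$ is obtained from $G$ by a dual-of-a-join-summand move. Two ribbon graphs are related by dualling join-summands if there is a sequence of dual-of-a-join-summand moves taking one to the other, or if they are geometric duals. -}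

module Defs where

-- Ribbon graphs are encoded combinatorially as graph-encoded maps (flag systems):
-- a finite set of flags Fin n with three fixed-point-free involutions
--   t0 : move to the other end of the edge (same edge, same side / face)
--   t1 : move round a corner of a vertex to the next edge-end (same vertex, same face)
--   t2 : move across an edge-end (same vertex, same edge)
-- with t0 t2 = t2 t0 and t0 x ≠ t2 x (edges are 4-flag orbits of <t0,t2>).
-- Vertices = orbits of <t1,t2>, edges = orbits of <t0,t2>, boundary components
-- (faces) = orbits of <t0,t1>.  Edgeless vertices carry no flags, so they are
-- recorded separately by the counter `iso`.

open import Data.Nat using (ℕ; _+_; _*_)
open import Data.Fin using (Fin)
open import Data.Bool using (Bool; true; false; if_then_else_; not)
open import Data.Product using (Σ; ∃; _×_; _,_)
open import Data.Sum using (_⊎_)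
open import Function using (_∘_)
open import Relation.Binary.PropositionalEquality using (_≡_; _≢_)
open import Relation.Binary.Construct.Closure.ReflexiveTransitive using (Star)

record RG : Set where
  constructor rg
  field
    n   : ℕ
    t0  : Fin n → Fin n
    t1  : Fin n → Fin n
    t2  : Fin n → Fin n
    iso : ℕ   -- number of isolated (edgeless) vertices

open RG public

FPFInvolution : {n : ℕ} → (Fin n → Fin n) → Set
FPFInvolution f = (∀ x → f (f x) ≡ x) × (∀ x → f x ≢ x)

IsRG : RG → Set
IsRG G = FPFInvolution (t0 G) × FPFInvolution (t1 G) × FPFInvolution (t2 G)
       × (∀ x → t0 G (t2 G x) ≡ t2 G (t0 G x))
       × (∀ x → t0 G x ≢ t2 G x)

module _ (G : RG) where
  SameVertex : Fin (n G) → Fin (n G) → Set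
  SameVertex = Star (λ x y → y ≡ t1 G x ⊎ y ≡ t2 G x)

  SameEdge : Fin (n G) → Fin (n G) → Set
  SameEdge = Star (λ x y → y ≡ t0 G x ⊎ y ≡ t2 G x)

  SameFace : Fin (n G) → Fin (n G) → Set
  SameFace = Star (λ x y → y ≡ t0 G x ⊎ y ≡ t1 G x)

  SameComponent : Fin (n G) → Fin (n G) → Set
  SameComponent = Star (λ x y → y ≡ t0 G x ⊎ y ≡ t1 G x ⊎ y ≡ t2 G x)

OrbitCount : {n : ℕ} → (Fin n → Fin n → Set) → ℕ → Set
OrbitCount {n} R k =
  Σ (Fin n → Fin k) λ f →
    (∀ j → ∃ λ x → f x ≡ j) × (∀ x y → (f x ≡ f y → R x y) × (R x y → f x ≡ f y))

NumVertices NumEdges NumFaces NumComponents : RG → ℕ → Set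
NumVertices G k   = ∃ λ c → OrbitCount (SameVertex G) c × k ≡ c + iso G
NumEdges G k      = OrbitCount (SameEdge G) k
NumFaces G k      = ∃ λ c → OrbitCount (SameFace G) c × k ≡ c + iso G
NumComponents G k = ∃ λ c → OrbitCount (SameComponent G) c × k ≡ c + iso G

EulerGenus : RG → ℕ → Set
EulerGenus G g = ∃ λ k → ∃ λ v → ∃ λ e → ∃ λ f →
  NumComponents G k × NumVertices G v × NumEdges G e × NumFaces G f
  × v + f + g ≡ e + 2 * k

Connected : RG → Set
Connected G = NumComponents G 1

Plane : RG → Set
Plane G = Connected G × EulerGenus G 0

RP2 : RG → Set
RP2 G = Connected G × EulerGenus G 1

record _≅_ (G H : RG) : Set where
  field
    to      : Fin (n G) → Fin (n H)
    from    : Fin (n H) → Fin (n G)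
    from∘to : ∀ x → from (to x) ≡ x
    to∘from : ∀ y → to (from y) ≡ y
    com0    : ∀ x → to (t0 G x) ≡ t0 H (to x)
    com1    : ∀ x → to (t1 G x) ≡ t1 H (to x)
    com2    : ∀ x → to (t2 G x) ≡ t2 H (to x)
    isoEq   : iso G ≡ iso H

-- a set of edges, given as its characteristic function on flags
IsEdgeSet : (G : RG) → (Fin (n G) → Bool) → Set
IsEdgeSet G A = (∀ x → A (t0 G x) ≡ A x) × (∀ x → A (t2 G x) ≡ A x)

partialDual : (G : RG) → (Fin (n G) → Bool) → RG
partialDual G A = rg (n G)
  (λ x → if A x then t2 G x else t0 G x)
  (t1 G)
  (λ x → if A x then t0 G x else t2 G x)
  (iso G)

dual : RG → RG
dual G = partialDual G (λ _ → true)

PartialDuals : RG → RG → Set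
PartialDuals G H = Σ (Fin (n G) → Bool) λ A → IsEdgeSet G A × (partialDual G A ≅ H)

-- G = P ∨ Q where E(P) = {A = true}, E(Q) = {A = false}
module _ (G : RG) (A : Fin (n G) → Bool) where
  SubStep : Bool → Fin (n G) → Fin (n G) → Set
  SubStep b x y = A x ≡ b × A y ≡ b × (SameEdge G x y ⊎ SameVertex G x y)

  PQCorner : Fin (n G) → Fin (n G) → Set
  PQCorner pv a = SameVertex G a pv × A a ≡ true × A (t1 G a) ≡ false

  record IsJoin : Set where
    field
      edgeSet : IsEdgeSet G A
      -- the common vertex v, witnessed by a P-flag and a Q-flag at it
      pv      : Fin (n G)
      qv      : Fin (n G)
      pvP     : A pv ≡ true
      qvQ     : A qv ≡ false
      pvqv    : SameVertex G pv qv
      meet    : ∀ x y → A x ≡ true → A y ≡ false → SameVertex G x y → SameVertex G x pv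
      Pconn   : ∀ x y → A x ≡ true → A y ≡ true → Star (SubStep true) x y
      Qconn   : ∀ x y → A x ≡ false → A y ≡ false → Star (SubStep false) x y
      -- the edge-ends of P at v are consecutive around v (an arc meets all of
      -- them and none of Q): exactly two P/Q corners at v
      c₁      : Fin (n G)
      c₂      : Fin (n G)
      c₁≢c₂   : c₁ ≢ c₂
      c₁corner : PQCorner pv c₁
      c₂corner : PQCorner pv c₂
      only    : ∀ z → PQCorner pv z → z ≡ c₁ ⊎ z ≡ c₂

Move : RG → RG → Set
Move G H = Σ (Fin (n G) → Bool) λ A → IsJoin G A × (partialDual G (not ∘ A) ≅ H)

RelatedByDuallingJoinSummands : RG → RG → Set
RelatedByDuallingJoinSummands G H =
  (Σ RG λ K → Star Move G K × (K ≅ H)) ⊎ (dual G ≅ H)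

{-# OPTIONS --safe #-}
module Submission where

-- A join of a connected ribbon graph is an edge set P that t1 leaves at exactly two flags, and this
-- notion is unaffected by partial duality (which only exchanges t0 and t2).  So it suffices to write
-- A, up to complement, as a symmetric difference of edge sets with two crossings; the moves along
-- these sets then compose to G^A.
--
-- Induct on the number of crossings of A, letting t1 vary.  Follow the boundary curve of a vertex, or
-- of a face, from a crossing until it next meets a crossing; this gives two involutions ρ2 and ρ0 on
-- the set X of crossing flags.  If no two of the pairings that they induce on the two sides of A
-- agree anywhere, then every vertex and face meeting X is long, and Euler's inequality
-- v + f ≤ e + 2k for the system with t1 replaced by ρ2 on X gives v + f ≤ e + 2(k - 1), so the Euler
-- genus is at least 2.  Hence two pairings agree at some c with common value c′.  Reconnecting
-- c - t1 c and c′ - t1 c′ to c - c′ and t1 c - t1 c′ then adds a vertex and a face to G or to G^A, and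
-- as the Euler genus is at most 1 and stays nonnegative, it adds a component: {c, c′} is a
-- two-crossing cut.  The reconnected system has fewer crossings and the same genera.

open import Defs hiding (n)
open import Algebra.Properties.CommutativeMonoid.Sum using (sum; ∑-distrib-+; ∑-comm)
open import Data.Bool using (Bool; true; false; if_then_else_; not; _∧_; _∨_; _xor_)
open import Data.Bool.Properties using (¬-not; not-¬; not-involutive; ∨-zeroʳ; ∧-zeroʳ; xor-comm; xor-assoc; xor-identityʳ)
open import Data.Empty using (⊥; ⊥-elim)
open import Data.Fin using (Fin; zero; suc; toℕ)
open import Data.Fin.Patterns using (0F; 1F; 2F; 3F)
open import Data.Fin.Properties using (_≟_; any?; pigeonhole)
open import Data.List using (List; []; _∷_; foldr; allFin)
open import Data.List.Membership.Propositional using (_∈_)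
open import Data.List.Membership.Propositional.Properties using (∈-allFin)
open import Data.List.Relation.Unary.All using (All; []; _∷_)
open import Data.List.Relation.Unary.Any using (here; there)
open import Data.Maybe using (Maybe; just; nothing)
open import Data.Maybe.Properties using (just-injective)
open import Data.Nat using (ℕ; zero; suc; _+_; _*_; _≤_; _<_; z≤n; s≤s)
open import Data.Nat.Properties hiding (_≟_)
open import Data.Nat.Solver using (module +-*-Solver)
open import Data.Product using (Σ; ∃; _×_; _,_; proj₁; proj₂)
open import Data.Sum using (_⊎_; inj₁; inj₂)
open import Function using (_∘_; id; const)
open import Function.Bundles using (_⇔_; mk⇔)
open import Relation.Binary.Construct.Closure.ReflexiveTransitive using (Star; ε; _◅_; _◅◅_; gmap; reverse)
open import Relation.Binary.PropositionalEquality
open import Relation.Binary.Structures using (IsEquivalence)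
open import Relation.Nullary using (¬_; yes; no)
open import Relation.Nullary.Decidable using (isYes)
import Data.Bool as Bool

-- At a crossing, A is left on one side and its complement on the other, so arcs of vertex and face
-- curves start on both sides. The kind of agreement decides which graph to look at. A vertex arc
-- and a face arc on the same side lie on a vertex and a face of G. Two vertex arcs, or two face
-- arcs, on opposite sides are a vertex arc and a face arc of G^A, because partial duality exchanges
-- the two kinds inside A only. Hence the genus bounds of both G and G^A are carried through the
-- induction. Reconnecting, unlike deleting or contracting edges, keeps the flags, t0, t2 and A, so
-- the induction stays on one flag set and alters t1 alone. The price is that the reconnected system
-- is disconnected, so genus bounds are stated with the number of components. In the absence of
-- agreements the curves are long because two fixed-point-free pairings that disagree everywhere
-- generate only orbits with at least four elements.

private variable
  n m : ℕ

-- Cardinalities of subsets of Fin n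

Subset : ℕ → Set
Subset n = Fin n → Bool

_∋_ : Subset n → Fin n → Set
P ∋ x = P x ≡ true

infix 4 _∋_ _==_

_==_ : Fin n → Fin n → Bool
x == y = isYes (x ≟ y)

==⇒≡ : {x y : Fin n} → (x == y) ≡ true → x ≡ y
==⇒≡ {x = x} {y} e with x ≟ y
... | yes p = p
==⇒≡ () | no _

≡⇒== : {x y : Fin n} → x ≡ y → (x == y) ≡ true
≡⇒== {x = x} {y} e with x ≟ y
... | yes _ = refl
... | no ¬p = ⊥-elim (¬p e)

≢⇒== : {x y : Fin n} → x ≢ y → (x == y) ≡ false
≢⇒== {x = x} {y} ne with x ≟ y
... | yes p = ⊥-elim (ne p)
... | no _ = refl

true≢false : {b : Bool} → b ≡ true → b ≡ false → ⊥
true≢false refl ()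

∧-intro : {a b : Bool} → a ≡ true → b ≡ true → a ∧ b ≡ true
∧-intro refl refl = refl

∧-fst : (a : Bool) {b : Bool} → a ∧ b ≡ true → a ≡ true
∧-fst true _ = refl

∧-snd : (a : Bool) {b : Bool} → a ∧ b ≡ true → b ≡ true
∧-snd true e = e

not-true : {a : Bool} → not a ≡ true → a ≡ false
not-true {false} _ = refl

⇔⇒≡ : (a b : Bool) → (a ≡ true → b ≡ true) → (b ≡ true → a ≡ true) → a ≡ b
⇔⇒≡ true b f g = sym (f refl)
⇔⇒≡ false true f g = g refl
⇔⇒≡ false false f g = refl

if-true : {A : Set} {b : Bool} {x y : A} → b ≡ true → (if b then x else y) ≡ x
if-true refl = refl

if-false : {A : Set} {b : Bool} {x y : A} → b ≡ false → (if b then x else y) ≡ y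
if-false refl = refl

decide : (P : Subset n) → (∃ λ x → P ∋ x) ⊎ (∀ x → P x ≡ false)
decide P with any? (λ x → P x Bool.≟ true)
... | yes p = inj₁ p
... | no ¬p = inj₂ (λ x → ¬-not (λ e → ¬p (x , e)))

∑ : (Fin n → ℕ) → ℕ
∑ = sum +-0-commutativeMonoid

∑-mono : {f g : Fin n → ℕ} → (∀ i → f i ≤ g i) → ∑ f ≤ ∑ g
∑-mono {zero} h = z≤n
∑-mono {suc n} h = +-mono-≤ (h zero) (∑-mono (h ∘ suc))

term≤∑ : (f : Fin n → ℕ) (i : Fin n) → f i ≤ ∑ f
term≤∑ f zero = m≤m+n _ _
term≤∑ f (suc i) = ≤-trans (term≤∑ (f ∘ suc) i) (m≤n+m _ (f zero))

*-∑ : (a : ℕ) (f : Fin n → ℕ) → a * ∑ f ≡ ∑ (λ i → a * f i)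
*-∑ {zero} a f = *-zeroʳ a
*-∑ {suc n} a f = trans (*-distribˡ-+ a (f zero) _) (cong (a * f zero +_) (*-∑ a (f ∘ suc)))

ι : Bool → ℕ
ι true = 1
ι false = 0

card : Subset n → ℕ
card P = ∑ (ι ∘ P)

ι≤1 : (b : Bool) → ι b ≤ 1
ι≤1 true = ≤-refl
ι≤1 false = z≤n

ι-mono : (a b : Bool) → (a ≡ true → b ≡ true) → ι a ≤ ι b
ι-mono true b h rewrite h refl = ≤-refl
ι-mono false b h = z≤n

card-mono : {P Q : Subset n} → (∀ x → P ∋ x → Q ∋ x) → card P ≤ card Q
card-mono {P = P} {Q} h = ∑-mono (λ x → ι-mono (P x) (Q x) (h x))

card-none : (P : Subset n) → (∀ x → P x ≡ false) → card P ≤ 0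
card-none {zero} P h = z≤n
card-none {suc n} P h rewrite h zero = card-none (P ∘ suc) (h ∘ suc)

card-≤1 : (P : Subset n) → (∀ x y → P ∋ x → P ∋ y → x ≡ y) → card P ≤ 1
card-≤1 {zero} P h = z≤n
card-≤1 {suc n} P h with P zero in eq
... | true = s≤s (card-none (P ∘ suc) λ x → ¬-not λ e → 0≢suc (h zero (suc x) eq e))
  where
  0≢suc : {x : Fin n} → zero ≢ suc x
  0≢suc ()
... | false = card-≤1 (P ∘ suc) λ x y px py → suc-inj (h (suc x) (suc y) px py)
  where
  suc-inj : {x y : Fin n} → suc x ≡ suc y → x ≡ y
  suc-inj refl = refl

double-count : (B : Fin n → Fin m → Bool) (P : Subset n) (Q : Subset m) (a b : ℕ) →
  (∀ x → P ∋ x → a ≤ card (B x)) →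
  (∀ y → Q ∋ y → card (λ x → B x y) ≤ b) →
  (∀ x y → B x y ≡ true → Q ∋ y) →
  a * card P ≤ b * card Q
double-count B P Q a b lo hi sub = begin
  a * card P                          ≡⟨ *-∑ a (ι ∘ P) ⟩
  ∑ (λ x → a * ι (P x))               ≤⟨ ∑-mono low ⟩
  ∑ (λ x → ∑ λ y → ι (B x y))         ≡⟨ ∑-comm +-0-commutativeMonoid (λ x y → ι (B x y)) ⟩
  ∑ (λ y → ∑ λ x → ι (B x y))         ≤⟨ ∑-mono high ⟩
  ∑ (λ y → b * ι (Q y))               ≡⟨ *-∑ b (ι ∘ Q) ⟨
  b * card Q                          ∎
  where
  open ≤-Reasoning
  low : ∀ x → a * ι (P x) ≤ card (B x)
  low x with P x in e
  ... | true = ≤-trans (≤-reflexive (*-identityʳ a)) (lo x e)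
  ... | false = ≤-trans (≤-reflexive (*-zeroʳ a)) z≤n
  high : ∀ y → card (λ x → B x y) ≤ b * ι (Q y)
  high y with Q y in e
  ... | true = ≤-trans (hi y e) (≤-reflexive (sym (*-identityʳ b)))
  ... | false = ≤-trans (card-none (λ x → B x y) (λ x → ¬-not (λ e′ → true≢false (sub x y e′) e))) z≤n

-- Double counting on the graph of `f`, where both degree bounds are 1.
card-inj : {P : Subset n} {Q : Subset m} (f : Fin n → Fin m) →
  (∀ x → P ∋ x → Q ∋ f x) →
  (∀ x y → P ∋ x → P ∋ y → f x ≡ f y → x ≡ y) → card P ≤ card Q
card-inj {P = P} {Q} f h inj = subst₂ _≤_ (*-identityˡ _) (*-identityˡ _)
  (double-count (λ x y → P x ∧ (f x == y)) P Q 1 1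
    (λ x px → ≤-trans (≤-reflexive (sym (cong ι (∧-intro px (≡⇒== refl)))))
                      (term≤∑ (λ y → ι (P x ∧ (f x == y))) (f x)))
    (λ y _ → card-≤1 _ λ x x′ e e′ → inj x x′ (∧-fst (P x) e) (∧-fst (P x′) e′)
       (trans (==⇒≡ (∧-snd (P x) e)) (sym (==⇒≡ (∧-snd (P x′) e′)))))
    (λ x y e → subst (Q ∋_) (==⇒≡ (∧-snd (P x) e)) (h x (∧-fst (P x) e))))

card-strict : {P Q : Subset n} (a : Fin n) → (∀ x → P ∋ x → Q ∋ x) →
  P a ≡ false → Q ∋ a → suc (card P) ≤ card Q
card-strict {P = P} {Q} a h pa qa = begin
  suc (card P)                             ≡⟨ +-comm 1 (card P) ⟩
  card P + 1                               ≤⟨ +-monoʳ-≤ (card P) one ⟩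
  card P + card (_== a)                    ≡⟨ ∑-distrib-+ +-0-commutativeMonoid (ι ∘ P) (λ x → ι (x == a)) ⟨
  ∑ (λ x → ι (P x) + ι (x == a))           ≤⟨ ∑-mono pt ⟩
  card Q                                   ∎
  where
  open ≤-Reasoning
  one : 1 ≤ card (_== a)
  one = ≤-trans (≤-reflexive (sym (cong ι (≡⇒== {x = a} refl)))) (term≤∑ (λ x → ι (x == a)) a)
  pt : ∀ x → ι (P x) + ι (x == a) ≤ ι (Q x)
  pt x with x ≟ a
  ... | yes refl rewrite pa | qa = ≤-refl
  ... | no _ = ≤-trans (≤-reflexive (+-identityʳ _)) (ι-mono (P x) (Q x) (h x))

card-singleton : (a : Fin n) → card (_== a) ≤ 1
card-singleton a = card-≤1 (_== a) λ u v e e′ → trans (==⇒≡ {x = u} {a} e) (sym (==⇒≡ {x = v} {a} e′))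

card-split : (P Q : Subset n) → card P ≡ card (λ x → P x ∧ not (Q x)) + card (λ x → P x ∧ Q x)
card-split P Q = trans (∑-cong λ x → pt (P x) (Q x))
  (∑-distrib-+ +-0-commutativeMonoid (λ x → ι (P x ∧ not (Q x))) (λ x → ι (P x ∧ Q x)))
  where
  ∑-cong : {f g : Fin n → ℕ} → (∀ i → f i ≡ g i) → ∑ f ≡ ∑ g
  ∑-cong h = ≤-antisym (∑-mono (λ i → ≤-reflexive (h i))) (∑-mono (λ i → ≤-reflexive (sym (h i))))
  pt : ∀ a b → ι a ≡ ι (a ∧ not b) + ι (a ∧ b)
  pt true true = refl
  pt true false = refl
  pt false b = refl

-- Partitions of Fin n, presented by a choice of representatives

record Part (n : ℕ) : Set where
  field
    cls  : Fin n → Fin n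
    idem : ∀ x → cls (cls x) ≡ cls x

open Part public

_⊢_∼_ : Part n → Fin n → Fin n → Set
p ⊢ x ∼ y = cls p x ≡ cls p y

infix 4 _⊢_∼_ _⊑_

_⊑_ : Part n → Part n → Set
p ⊑ q = ∀ {x y} → p ⊢ x ∼ y → q ⊢ x ∼ y

fix : Part n → Subset n
fix p x = cls p x == x

fix-cls : (p : Part n) (x : Fin n) → fix p ∋ cls p x
fix-cls p x = ≡⇒== (idem p x)

∼-equiv : (p : Part n) → IsEquivalence (p ⊢_∼_)
∼-equiv p = record { refl = refl ; sym = sym ; trans = trans }

abstract
  count : Part n → ℕ
  count p = card (fix p)

  count-def : (p : Part n) → count p ≡ card (fix p)
  count-def p = refl

  count-mono : {p q : Part n} → p ⊑ q → count q ≤ count p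
  count-mono {p = p} {q} h = card-inj (cls p) (λ x _ → fix-cls p x)
    (λ x y fx fy e → trans (sym (==⇒≡ fx)) (trans (h e) (==⇒≡ fy)))

discrete : Part n
discrete = record { cls = id ; idem = λ _ → refl }

abstract
  merge : Part n → Fin n → Fin n → Part n
  merge {n} p x y = record { cls = c ; idem = i }
    where
    c : Fin n → Fin n
    c z = if cls p z == cls p x then cls p y else cls p z
    c-cls-y : c (cls p y) ≡ cls p y
    c-cls-y with cls p (cls p y) == cls p x
    ... | true = refl
    ... | false = idem p y
    i : ∀ z → c (c z) ≡ c z
    i z with cls p z == cls p x in e
    ... | true = c-cls-y
    ... | false = trans (cong (λ w → if w == cls p x then cls p y else w) (idem p z)) (if-false e)

  merge-⊒ : (p : Part n) (x y : Fin n) → p ⊑ merge p x y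
  merge-⊒ p x y e = cong (λ w → if w == cls p x then cls p y else w) e

  merge-∼ : (p : Part n) (x y : Fin n) → merge p x y ⊢ x ∼ y
  merge-∼ p x y = trans (if-true (≡⇒== {x = cls p x} refl)) (sym h)
    where
    h : cls (merge p x y) y ≡ cls p y
    h with cls p y == cls p x
    ... | true = refl
    ... | false = refl

  merge-elim : (p : Part n) (x y : Fin n) {Q : Fin n → Fin n → Set} → IsEquivalence Q →
    (∀ {u v} → p ⊢ u ∼ v → Q u v) → Q x y → ∀ {u v} → merge p x y ⊢ u ∼ v → Q u v
  merge-elim p x y {Q} eq h q {u} {v} e =
    E.trans (toRep u) (subst (λ w → Q w v) (sym e) (E.sym (toRep v)))
    where
    module E = IsEquivalence eq
    toRep : ∀ z → Q z (cls (merge p x y) z)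
    toRep z with cls p z ≟ cls p x
    ... | yes e = E.trans (h e) (E.trans q (h (sym (idem p y))))
    ... | no _ = h (sym (idem p z))

  merge-count-≤ : (p : Part n) (x y : Fin n) → count p ≤ suc (count (merge p x y))
  merge-count-≤ {n} p x y = begin
    count p                                       ≤⟨ ∑-mono pt ⟩
    ∑ (λ z → ι (fix q z) + ι (z == cls p x))      ≡⟨ ∑-distrib-+ +-0-commutativeMonoid (ι ∘ fix q) _ ⟩
    count q + card (_== cls p x)                  ≤⟨ +-monoʳ-≤ (count q) (card-singleton (cls p x)) ⟩
    count q + 1                                   ≡⟨ +-comm (count q) 1 ⟩
    suc (count q)                                 ∎
    where
    open ≤-Reasoning
    q : Part n
    q = merge p x y
    pt : ∀ z → ι (fix p z) ≤ ι (fix q z) + ι (z == cls p x)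
    pt z with z ≟ cls p x
    ... | yes _ = ≤-trans (ι≤1 (fix p z)) (m≤n+m 1 _)
    ... | no ne = ≤-trans (ι-mono (fix p z) (fix q z) λ e →
            ≡⇒== (trans (if-false (≢⇒== (λ e′ → ne (trans (sym (==⇒≡ e)) e′)))) (==⇒≡ e)))
            (≤-reflexive (sym (+-identityʳ _)))

  merge-count-< : (p : Part n) (x y : Fin n) → ¬ (p ⊢ x ∼ y) → suc (count (merge p x y)) ≤ count p
  merge-count-< p x y ne = card-strict (cls p x) sub
    (≢⇒== (λ e → ne (sym (trans (sym (if-true (≡⇒== (idem p x)))) e))))
    (fix-cls p x)
    where
    sub : ∀ z → fix (merge p x y) ∋ z → fix p ∋ z
    sub z e with cls p z ≟ cls p x
    ... | yes e′ = ⊥-elim (ne (trans (sym e′) (trans (cong (cls p) (sym (==⇒≡ e))) (idem p y))))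
    ... | no _ = e

-- The partition generated by a list of functions g, each relating x to g x

abstract
  mergeAll : (Fin n → Fin n) → Part n → List (Fin n) → Part n
  mergeAll g = foldr (λ x q → merge q x (g x))

  gen : List (Fin n → Fin n) → Part n
  gen [] = discrete
  gen {n} (g ∷ gs) = mergeAll g (gen gs) (allFin n)

  mergeAll-⊒ : (g : Fin n → Fin n) (p : Part n) (xs : List (Fin n)) → p ⊑ mergeAll g p xs
  mergeAll-⊒ g p [] e = e
  mergeAll-⊒ g p (x ∷ xs) e = merge-⊒ (mergeAll g p xs) x (g x) (mergeAll-⊒ g p xs e)

  mergeAll-∼ : (g : Fin n → Fin n) (p : Part n) {xs : List (Fin n)} {x : Fin n} → x ∈ xs →
    mergeAll g p xs ⊢ x ∼ g x
  mergeAll-∼ g p {x ∷ xs} (here refl) = merge-∼ (mergeAll g p xs) x (g x)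
  mergeAll-∼ g p {y ∷ xs} (there i) = merge-⊒ (mergeAll g p xs) y (g y) (mergeAll-∼ g p i)

  mergeAll-elim : (g : Fin n → Fin n) (p : Part n) (xs : List (Fin n)) {Q : Fin n → Fin n → Set} →
    IsEquivalence Q → (∀ {u v} → p ⊢ u ∼ v → Q u v) → (∀ x → Q x (g x)) →
    ∀ {u v} → mergeAll g p xs ⊢ u ∼ v → Q u v
  mergeAll-elim g p [] eq h q e = h e
  mergeAll-elim g p (x ∷ xs) eq h q =
    merge-elim (mergeAll g p xs) x (g x) eq (mergeAll-elim g p xs eq h q) (q x)

  gen-∼ : {gs : List (Fin n → Fin n)} {g : Fin n → Fin n} → g ∈ gs → ∀ x → gen gs ⊢ x ∼ g x
  gen-∼ {gs = g ∷ gs} (here refl) x = mergeAll-∼ g (gen gs) (∈-allFin x)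
  gen-∼ {gs = g ∷ gs} (there i) x = mergeAll-⊒ g (gen gs) (allFin _) (gen-∼ i x)

  -- Leastness among equivalences. Comparisons of orbit counts thereby reduce to checking each
  -- generator, and counts decrease when a partition gets coarser.
  gen-elim : (gs : List (Fin n → Fin n)) {Q : Fin n → Fin n → Set} → IsEquivalence Q →
    All (λ g → ∀ x → Q x (g x)) gs → ∀ {u v} → gen gs ⊢ u ∼ v → Q u v
  gen-elim [] eq [] refl = IsEquivalence.refl eq
  gen-elim (g ∷ gs) eq (q ∷ qs) = mergeAll-elim g (gen gs) (allFin _) eq (gen-elim gs eq qs) q

gen-⊑ : (gs : List (Fin n → Fin n)) (p : Part n) →
  All (λ g → ∀ x → p ⊢ x ∼ g x) gs → gen gs ⊑ p
gen-⊑ gs p = gen-elim gs (∼-equiv p)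

≡-on : {B : Set} (f : Fin n → B) → IsEquivalence (λ x y → f x ≡ f y)
≡-on f = record { refl = refl ; sym = sym ; trans = trans }

pattern 0th = here refl
pattern 1st = there (here refl)
pattern 2nd = there (there (here refl))
pattern 3rd = there (there (there (here refl)))

-- Classes meeting a set X

meets : Part n → Subset n → Subset n
meets p X z = isYes (any? (λ w → (X w ∧ (cls p w == cls p z)) Bool.≟ true))

meets-intro : (p : Part n) (X : Subset n) {w z : Fin n} → X ∋ w → p ⊢ w ∼ z → meets p X ∋ z
meets-intro p X {w} {z} xw e with any? (λ w → (X w ∧ (cls p w == cls p z)) Bool.≟ true)
... | yes _ = refl
... | no ¬p = ⊥-elim (¬p (w , ∧-intro xw (≡⇒== e)))

meets-elim : (p : Part n) (X : Subset n) {z : Fin n} → meets p X ∋ z → ∃ λ w → X ∋ w × p ⊢ w ∼ z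
meets-elim p X {z} m with any? (λ w → (X w ∧ (cls p w == cls p z)) Bool.≟ true)
... | yes (w , e) = w , ∧-fst (X w) e , ==⇒≡ (∧-snd (X w) e)
meets-elim p X () | no _

meets-resp : (p : Part n) (X : Subset n) {x y : Fin n} → p ⊢ x ∼ y → meets p X x ≡ meets p X y
meets-resp p X e = cong (λ c → isYes (any? (λ w → (X w ∧ (cls p w == c)) Bool.≟ true))) e

countIn countOff : Part n → Subset n → ℕ
countIn p X = card (λ z → fix p z ∧ meets p X z)
countOff p X = card (λ z → fix p z ∧ not (meets p X z))

count-split : (p : Part n) (X : Subset n) → count p ≡ countOff p X + countIn p X
count-split p X = trans (count-def p) (card-split (fix p) (meets p X))

-- Collapses all classes meeting `X` to one value and keeps the others apart. Two partitions that
-- differ only in how they arrange the classes through `X` can then be compared away from `X`.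
offClass : Part n → Subset n → Fin n → Maybe (Fin n)
offClass p X z = if meets p X z then nothing else just (cls p z)

offClass-resp : (p : Part n) (X : Subset n) {x y : Fin n} → p ⊢ x ∼ y → offClass p X x ≡ offClass p X y
offClass-resp p X e = cong₂ (λ b c → if b then nothing else just c) (meets-resp p X e) e

offClass-in : (p : Part n) (X : Subset n) {x : Fin n} → X ∋ x → offClass p X x ≡ nothing
offClass-in p X xx = if-true (meets-intro p X xx refl)

-- A representative `z` of a p-class missing `X` is sent to its q-class. That q-class misses `X`
-- too, since a member in `X` would force `offClass p X z` to be `nothing`.
countOff-mono : (p q : Part n) (X : Subset n) →
  (∀ {x y} → q ⊢ x ∼ y → offClass p X x ≡ offClass p X y) → countOff p X ≤ countOff q X
countOff-mono p q X h = card-inj (cls q)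
  (λ z e → ∧-intro (fix-cls q z) (cong not (¬-not λ m → hit z (off z e) m)))
  (λ z z′ e e′ r → trans (sym (==⇒≡ (∧-fst (fix p z) e)))
     (trans (just-injective (trans (sym (off z e)) (trans (h r) (off z′ e′)))) (==⇒≡ (∧-fst (fix p z′) e′))))
  where
  off : ∀ z → fix p z ∧ not (meets p X z) ≡ true → offClass p X z ≡ just (cls p z)
  off z e = if-false (not-true (∧-snd (fix p z) e))
  hit : ∀ z → offClass p X z ≡ just (cls p z) → meets q X ∋ cls q z → ⊥
  hit z o m with meets-elim q X m
  ... | w , xw , r with trans (sym (offClass-in p X xw)) (trans (h (trans r (idem q z))) o)
  ... | ()

countIn-mono : (p q : Part n) (X : Subset n) → p ⊑ q → countIn q X ≤ countIn p X
countIn-mono {n} p q X h = card-inj (λ z → rep z)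
  (λ z e → let w , xw , _ , r = rep-meets z (∧-snd (fix q z) e) in
     subst (λ v → fix p v ∧ meets p X v ≡ true) (sym r)
       (∧-intro (fix-cls p w) (meets-intro p X xw (sym (idem p w)))))
  (λ z z′ e e′ r →
     let w , _ , s , t = rep-meets z (∧-snd (fix q z) e)
         w′ , _ , s′ , t′ = rep-meets z′ (∧-snd (fix q z′) e′)
     in trans (sym (==⇒≡ (∧-fst (fix q z) e)))
          (trans (trans (sym s) (trans (h (trans (sym t) (trans r t′))) s′)) (==⇒≡ (∧-fst (fix q z′) e′))))
  where
  -- The p-class of a q-representative may miss `X` even if its q-class does not, so the class is
  -- first moved to a member in `X`.
  rep : Fin n → Fin n
  rep z with any? (λ w → (X w ∧ (cls q w == cls q z)) Bool.≟ true)
  ... | yes (w , _) = cls p w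
  ... | no _ = z
  rep-meets : ∀ z → meets q X ∋ z → ∃ λ w → X ∋ w × q ⊢ w ∼ z × rep z ≡ cls p w
  rep-meets z m with any? (λ w → (X w ∧ (cls q w == cls q z)) Bool.≟ true)
  ... | yes (w , e) = w , ∧-fst (X w) e , ==⇒≡ (∧-snd (X w) e) , refl
  rep-meets z () | no _

countIn-pos : (p : Part n) (X : Subset n) {x : Fin n} → X ∋ x → 1 ≤ countIn p X
countIn-pos p X {x} xx = ≤-trans
  (≤-reflexive (sym (cong ι (∧-intro (fix-cls p x) (meets-intro p X xx (sym (idem p x)))))))
  (term≤∑ (λ z → ι (fix p z ∧ meets p X z)) (cls p x))

record FourIn (p : Part n) (Y : Subset n) (w : Fin n) : Set where
  field
    elt     : Fin 4 → Fin n
    elt-in  : ∀ i → Y ∋ elt i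
    elt-∼   : ∀ i → p ⊢ elt i ∼ w
    elt-inj : ∀ i j → elt i ≡ elt j → i ≡ j

4*countIn≤ : (p : Part n) (X Y : Subset n) → (∀ w → X ∋ w → FourIn p Y w) → 4 * countIn p X ≤ card Y
4*countIn≤ p X Y h = subst (4 * countIn p X ≤_) (*-identityˡ _)
  (double-count (λ r y → Y y ∧ (fix p r ∧ (cls p y == r))) (λ z → fix p z ∧ meets p X z) Y 4 1
    (λ r e → let w , xw , s = meets-elim p X (∧-snd (fix p r) e)
                 open FourIn (h w xw)
             in card-inj {P = const true} elt
                  (λ i _ → ∧-intro (elt-in i) (∧-intro (∧-fst (fix p r) e)
                     (≡⇒== (trans (elt-∼ i) (trans s (==⇒≡ (∧-fst (fix p r) e)))))))
                  (λ i j _ _ → elt-inj i j))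
    (λ y _ → card-≤1 _ λ r r′ e e′ →
       trans (sym (==⇒≡ (∧-snd (fix p r) (∧-snd (Y y) e)))) (==⇒≡ (∧-snd (fix p r′) (∧-snd (Y y) e′))))
    (λ r y e → ∧-fst (Y y) e))

-- The four elements are `w`, `α w`, `β w` and `β (α w)`. As `β` is an involution, `β (α w) ≡ w`
-- would give `α w ≡ β w`, and `β (α w) ≡ β w` would give `α w ≡ w`.
four : {p : Part n} {Y : Subset n} (α β : Fin n → Fin n) →
  (∀ z → Y ∋ z → β (β z) ≡ z) →
  (∀ z → Y ∋ z → Y ∋ α z) → (∀ z → Y ∋ z → Y ∋ β z) →
  (∀ z → Y ∋ z → p ⊢ z ∼ α z) → (∀ z → Y ∋ z → p ⊢ z ∼ β z) →
  (∀ z → Y ∋ z → α z ≢ z) → (∀ z → Y ∋ z → β z ≢ z) → (∀ z → Y ∋ z → α z ≢ β z) →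
  ∀ w → Y ∋ w → FourIn p Y w
four {n} {p} {Y} α β ββ αY βY α∼ β∼ α≢ β≢ α≢β w yw = record
  { elt = elt ; elt-in = elt-in ; elt-∼ = elt-∼ ; elt-inj = elt-inj }
  where
  yα = αY w yw
  elt : Fin 4 → Fin n
  elt 0F = w
  elt 1F = α w
  elt 2F = β w
  elt 3F = β (α w)
  elt-in : ∀ i → Y ∋ elt i
  elt-in 0F = yw
  elt-in 1F = yα
  elt-in 2F = βY w yw
  elt-in 3F = βY (α w) yα
  elt-∼ : ∀ i → p ⊢ elt i ∼ w
  elt-∼ 0F = refl
  elt-∼ 1F = sym (α∼ w yw)
  elt-∼ 2F = sym (β∼ w yw)
  elt-∼ 3F = sym (trans (α∼ w yw) (β∼ (α w) yα))
  w≢βα : w ≢ β (α w)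
  w≢βα e = α≢β w yw (trans (sym (ββ (α w) yα)) (cong β (sym e)))
  β≢βα : β w ≢ β (α w)
  β≢βα e = α≢ w yw (sym (trans (sym (ββ w yw)) (trans (cong β e) (ββ (α w) yα))))
  elt-inj : ∀ i j → elt i ≡ elt j → i ≡ j
  elt-inj 0F 0F e = refl
  elt-inj 0F 1F e = ⊥-elim (α≢ w yw (sym e))
  elt-inj 0F 2F e = ⊥-elim (β≢ w yw (sym e))
  elt-inj 0F 3F e = ⊥-elim (w≢βα e)
  elt-inj 1F 0F e = ⊥-elim (α≢ w yw e)
  elt-inj 1F 1F e = refl
  elt-inj 1F 2F e = ⊥-elim (α≢β w yw e)
  elt-inj 1F 3F e = ⊥-elim (β≢ (α w) yα (sym e))
  elt-inj 2F 0F e = ⊥-elim (β≢ w yw e)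
  elt-inj 2F 1F e = ⊥-elim (α≢β w yw (sym e))
  elt-inj 2F 2F e = refl
  elt-inj 2F 3F e = ⊥-elim (β≢βα e)
  elt-inj 3F 0F e = ⊥-elim (w≢βα (sym e))
  elt-inj 3F 1F e = ⊥-elim (β≢ (α w) yα e)
  elt-inj 3F 2F e = ⊥-elim (β≢βα (sym e))
  elt-inj 3F 3F e = refl

card-≤2 : (P : Subset n) (u v : Fin n) → (∀ x → P ∋ x → x ≡ u ⊎ x ≡ v) → card P ≤ 2
card-≤2 P u v h = card-inj {Q = const true} f (λ _ _ → refl) inj
  where
  f : Fin _ → Fin 2
  f x = if x == u then 0F else 1F
  inj : ∀ x y → P ∋ x → P ∋ y → f x ≡ f y → x ≡ y
  inj x y px py e with x ≟ u | y ≟ u | h x px | h y py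
  ... | yes p | yes q | _ | _ = trans p (sym q)
  ... | no p | _ | inj₁ q | _ = ⊥-elim (p q)
  ... | _ | no p | _ | inj₁ q = ⊥-elim (p q)
  ... | no _ | no _ | inj₂ p | inj₂ q = trans p (sym q)
  inj x y px py () | yes _ | no _ | _ | _
  inj x y px py () | no _ | yes _ | _ | _

card≤2*countIn : (p : Part n) (X : Subset n) (ρ : Fin n → Fin n) →
  (∀ {x y} → X ∋ x → X ∋ y → p ⊢ x ∼ y → y ≡ x ⊎ y ≡ ρ x) → card X ≤ 2 * countIn p X
card≤2*countIn p X ρ h = subst (_≤ 2 * countIn p X) (*-identityˡ _)
  (double-count (λ y r → X y ∧ (cls p y == r)) X (λ z → fix p z ∧ meets p X z) 1 2
    (λ y xy → ≤-trans (≤-reflexive (sym (cong ι (∧-intro xy (≡⇒== {x = cls p y} refl)))))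
                      (term≤∑ (λ r → ι (X y ∧ (cls p y == r))) (cls p y)))
    (λ r e → let w , xw , s = meets-elim p X (∧-snd (fix p r) e)
                 fr = ==⇒≡ (∧-fst (fix p r) e)
             in card-≤2 _ w (ρ w) λ y e′ →
                  h xw (∧-fst (X y) e′) (trans s (trans fr (sym (==⇒≡ (∧-snd (X y) e′))))))
    (λ y r e → subst (λ r → fix p r ∧ meets p X r ≡ true) (==⇒≡ (∧-snd (X y) e))
       (∧-intro (fix-cls p y) (meets-intro p X (∧-fst (X y) e) (sym (idem p y))))))

-- Sets given by lists, and functions glued along a set

abstract
  oneOf : List (Fin n) → Subset n
  oneOf [] z = false
  oneOf (x ∷ xs) z = (z == x) ∨ oneOf xs z

  oneOf-elim : (xs : List (Fin n)) {z : Fin n} → oneOf xs ∋ z → z ∈ xs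
  oneOf-elim (x ∷ xs) {z} e with z ≟ x
  ... | yes p = here p
  ... | no _ = there (oneOf-elim xs e)

  oneOf-intro : {xs : List (Fin n)} {z : Fin n} → z ∈ xs → oneOf xs ∋ z
  oneOf-intro {xs = x ∷ xs} {z} i with z ≟ x
  ... | yes _ = refl
  oneOf-intro {xs = x ∷ xs} (here p) | no ¬p = ⊥-elim (¬p p)
  oneOf-intro {xs = x ∷ xs} (there i) | no _ = oneOf-intro i

true? : (b : Bool) → (b ≡ true) ⊎ (b ≡ false)
true? true = inj₁ refl
true? false = inj₂ refl

Invariant : Subset n → (Fin n → Fin n) → Set
Invariant A f = ∀ z → A (f z) ≡ A z

abstract
  -- The one gluing operation behind partial duals (`t0` and `t2` exchanged on an edge set), blocked
  -- involutions (identity on a set) and the replacement of `t1` by a return map.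
  mix : Subset n → (Fin n → Fin n) → (Fin n → Fin n) → Fin n → Fin n
  mix A f g z = if A z then f z else g z

  mix-true : (A : Subset n) {f g : Fin n → Fin n} {z : Fin n} → A ∋ z → mix A f g z ≡ f z
  mix-true A e = if-true e

  mix-false : (A : Subset n) {f g : Fin n → Fin n} {z : Fin n} → A z ≡ false → mix A f g z ≡ g z
  mix-false A e = if-false e

mix-involution : {A : Subset n} {f g : Fin n → Fin n} → Invariant A f → Invariant A g →
  FPFInvolution f → FPFInvolution g → FPFInvolution (mix A f g)
mix-involution {A = A} {f} {g} af ag (ff , fne) (gg , gne) = inv , ne
  where
  inv : ∀ z → mix A f g (mix A f g z) ≡ z
  inv z with true? (A z)
  ... | inj₁ e = trans (cong (mix A f g) (mix-true A e)) (trans (mix-true A (trans (af z) e)) (ff z))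
  ... | inj₂ e = trans (cong (mix A f g) (mix-false A e)) (trans (mix-false A (trans (ag z) e)) (gg z))
  ne : ∀ z → mix A f g z ≢ z
  ne z with true? (A z)
  ... | inj₁ e = λ e′ → fne z (trans (sym (mix-true A e)) e′)
  ... | inj₂ e = λ e′ → gne z (trans (sym (mix-false A e)) e′)

least : (P : ℕ → Bool) (k : ℕ) → P k ≡ true →
  ∃ λ K → P K ≡ true × (∀ {j} → j < K → P j ≡ false)
least P zero e = 0 , e , λ ()
least P (suc k) e with P 0 in eq
... | true = 0 , eq , λ ()
... | false with least (P ∘ suc) k e
... | K , eK , below = suc K , eK , λ { {zero} _ → eq ; {suc j} (s≤s l) → below l }

-- First return to a set X of the walk alternating between two involutions

off : (Fin n → Fin n) → Subset n → Fin n → Fin n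
off s X = mix X id s

-- The curves of `s` and `t` cut open at `X`: with `s` blocked there, the classes meeting `X` are
-- the arcs between consecutive visits.
cut : (s t : Fin n → Fin n) → Subset n → Part n
cut s t X = gen (t ∷ off s X ∷ [])

off-⊑ : {s t : Fin n → Fin n} {X Y : Subset n} → (∀ z → Y ∋ z → X ∋ z) → cut s t X ⊑ cut s t Y
off-⊑ {s = s} {t} {X} {Y} h = gen-⊑ _ (cut s t Y) (gen-∼ 0th ∷ step ∷ [])
  where
  step : ∀ z → cut s t Y ⊢ z ∼ off s X z
  step z with true? (X z)
  ... | inj₁ e = cong (cls (cut s t Y)) (sym (mix-true X e))
  ... | inj₂ e = trans (gen-∼ 1st z) (cong (cls (cut s t Y))
        (trans (mix-false Y (¬-not λ e′ → true≢false (h z e′) e)) (sym (mix-false X e))))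

cut-⊑ : (s t : Fin n → Fin n) (X : Subset n) → cut s t X ⊑ gen (t ∷ s ∷ [])
cut-⊑ s t X = gen-⊑ _ (gen (t ∷ s ∷ [])) (gen-∼ 0th ∷ step ∷ [])
  where
  step : ∀ z → gen (t ∷ s ∷ []) ⊢ z ∼ off s X z
  step z with true? (X z)
  ... | inj₁ e = cong (cls (gen (t ∷ s ∷ []))) (sym (mix-true X e))
  ... | inj₂ e = trans (gen-∼ 1st z) (cong (cls (gen (t ∷ s ∷ []))) (sym (mix-false X e)))

module FirstReturn {n : ℕ} (s t : Fin n → Fin n) (S : FPFInvolution s) (T : FPFInvolution t)
  (X : Subset n) (Xs : ∀ x → X ∋ x → X ∋ s x) where

  ss = proj₁ S
  tt = proj₁ T

  walk : Fin n → ℕ → Fin n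
  walk x zero = x
  walk x (suc k) = s (t (walk x k))

  st-inj : {x y : Fin n} → s (t x) ≡ s (t y) → x ≡ y
  st-inj {x} {y} e = trans (sym (tt x)) (trans (cong t (trans (sym (ss _)) (trans (cong s e) (ss _)))) (tt y))

  walk-cancel : ∀ x i d → walk x (i + d) ≡ walk x i → walk x d ≡ x
  walk-cancel x zero d e = e
  walk-cancel x (suc i) d e = walk-cancel x i d (st-inj e)

  -- By pigeonhole and injectivity of the step the walk comes back to `x`. The flag just before the
  -- last `s` is then `s x`, which lies in `X` since `X` is closed under `s`.
  returns : ∀ x → X ∋ x → ∃ λ k → X ∋ t (walk x k)
  returns x xx with pigeonhole (n<1+n n) (walk x ∘ toℕ)
  ... | i , j , i<j , e with m≤n⇒∃[o]m+o≡n i<j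
  ... | d , e′ = d , subst (X ∋_) eq (Xs x xx)
    where
    loop : s (t (walk x d)) ≡ x
    loop = walk-cancel x (toℕ i) (suc d)
      (trans (cong (walk x) (trans (+-suc (toℕ i) d) e′)) (sym e))
    eq : s x ≡ t (walk x d)
    eq = trans (cong s (sym loop)) (ss _)

  -- A walk running backwards along itself would have a fixed point in the middle.
  no-fold : ∀ x a d → t (walk x (a + d)) ≢ walk x a
  no-fold x a zero e rewrite +-identityʳ a = proj₂ T _ e
  no-fold x a (suc zero) e rewrite +-suc a 0 | +-identityʳ a =
    proj₂ S _ (trans (sym (tt _)) (cong t e))
  no-fold x a (suc (suc d)) e rewrite +-suc a (suc d) = no-fold x (suc a) d
    (trans (cong (t ∘ walk x) (sym (+-suc a d)))
      (trans (sym (ss _)) (cong s (trans (sym (tt _)) (cong t e)))))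

  record Return (x : Fin n) : Set where
    field
      ret      : Fin n
      ret-in   : X ∋ ret
      ret-≢    : ret ≢ x
      ret-∼    : cut s t X ⊢ x ∼ ret
      ret-only : ∀ z → X ∋ z → cut s t X ⊢ x ∼ z → z ≡ x ⊎ z ≡ ret

  off-inv : ∀ z → off s X (off s X z) ≡ z
  off-inv z with true? (X z)
  ... | inj₁ e = trans (cong (off s X) (mix-true X e)) (mix-true X e)
  ... | inj₂ e = trans (cong (off s X) (mix-false X e))
        (trans (mix-false X (¬-not λ e′ → true≢false (subst (X ∋_) (ss z) (Xs (s z) e′)) e)) (ss z))

  return : ∀ x → X ∋ x → Return x
  return x xx with returns x xx
  ... | k , xk with least (λ j → X (t (walk x j))) k xk
  ... | K , xK , below = record
    { ret = t (walk x K) ; ret-in = xK ; ret-≢ = no-fold x 0 K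
    ; ret-∼ = trans (path K ≤-refl) (gen-∼ 0th _) ; ret-only = λ z xz r → only z xz (proj₁ (elim r) (0 , z≤n , inj₁ refl)) }
    where
    -- The arc from `x` listed explicitly. It is closed under both generators of the cut, so it
    -- contains the class of `x`, and its only members in `X` are the two ends.
    U : Fin n → Set
    U z = ∃ λ k → k ≤ K × (z ≡ walk x k ⊎ z ≡ t (walk x k))
    path : ∀ k → k ≤ K → cut s t X ⊢ x ∼ walk x k
    path zero _ = refl
    path (suc k) l = trans (path k (<⇒≤ l)) (trans (gen-∼ 0th _) (trans (gen-∼ 1st _)
      (cong (cls (cut s t X)) (mix-false X (below l)))))
    U-t : ∀ {z} → U z → U (t z)
    U-t (k , l , inj₁ refl) = k , l , inj₂ refl
    U-t (k , l , inj₂ refl) = k , l , inj₁ (tt _)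
    U-s : ∀ {z} → X z ≡ false → U z → U (s z)
    U-s e (zero , l , inj₁ refl) = ⊥-elim (true≢false xx e)
    U-s e (suc k , l , inj₁ refl) = k , <⇒≤ l , inj₂ (ss _)
    U-s e (k , l , inj₂ refl) with m≤n⇒m<n∨m≡n l
    ... | inj₁ l′ = suc k , l′ , inj₁ refl
    ... | inj₂ refl = ⊥-elim (true≢false xK e)
    U-off : ∀ {z} → U z → U (off s X z)
    U-off {z} u with true? (X z)
    ... | inj₁ e = subst U (sym (mix-true X e)) u
    ... | inj₂ e = subst U (sym (mix-false X e)) (U-s e u)
    -- Closure under the generators is stated in both directions, because `gen-elim` needs an
    -- equivalence relation.
    elim : ∀ {u v} → cut s t X ⊢ u ∼ v → (U u → U v) × (U v → U u)
    elim = gen-elim _ {λ u v → (U u → U v) × (U v → U u)}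
      (record { refl = id , id ; sym = λ (f , g) → g , f ; trans = λ (f , g) (f′ , g′) → f′ ∘ f , g ∘ g′ })
      ((λ z → U-t , λ u → subst U (tt z) (U-t u)) ∷
       (λ z → U-off , λ u → subst U (off-inv z) (U-off u)) ∷ [])
    only : ∀ z → X ∋ z → U z → z ≡ x ⊎ z ≡ t (walk x K)
    only z xz (zero , l , inj₁ e) = inj₁ e
    only z xz (suc k , l , inj₁ refl) =
      ⊥-elim (true≢false (subst (X ∋_) (ss _) (Xs z xz)) (below l))
    only z xz (k , l , inj₂ refl) with m≤n⇒m<n∨m≡n l
    ... | inj₁ l′ = ⊥-elim (true≢false xz (below l′))
    ... | inj₂ refl = inj₂ refl

  -- Extended by the identity off `X`, so that the return map is defined on all flags.
  first : Fin n → Fin n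
  first x with true? (X x)
  ... | inj₁ e = Return.ret (return x e)
  ... | inj₂ _ = x

  first-return : ∀ {x} → X ∋ x → Σ (Return x) λ r → Return.ret r ≡ first x
  first-return {x} xx with true? (X x)
  ... | inj₁ e = return x e , refl
  ... | inj₂ e = ⊥-elim (true≢false xx e)

  abstract
    ρ : Fin n → Fin n
    ρ = first

    ρ-return : ∀ {x} → X ∋ x → Σ (Return x) λ r → Return.ret r ≡ ρ x
    ρ-return = first-return

  module _ {x : Fin n} (xx : X ∋ x) where
    ρ-in : X ∋ ρ x
    ρ-in = let r , e = ρ-return xx in subst (X ∋_) e (Return.ret-in r)
    ρ-≢ : ρ x ≢ x
    ρ-≢ = let r , e = ρ-return xx in subst (_≢ x) e (Return.ret-≢ r)
    ρ-∼ : cut s t X ⊢ x ∼ ρ x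
    ρ-∼ = let r , e = ρ-return xx in subst (cut s t X ⊢ x ∼_) e (Return.ret-∼ r)
    ρ-only : ∀ {z} → X ∋ z → cut s t X ⊢ x ∼ z → z ≡ x ⊎ z ≡ ρ x
    ρ-only {z} xz c = let r , e = ρ-return xx in subst (λ y → z ≡ x ⊎ z ≡ y) e (Return.ret-only r z xz c)

  ρ-unique : ∀ {x z} → X ∋ x → X ∋ z → z ≢ x → cut s t X ⊢ x ∼ z → z ≡ ρ x
  ρ-unique xx xz ne r with ρ-only xx xz r
  ... | inj₁ e = ⊥-elim (ne e)
  ... | inj₂ e = e

  ρ-unique₂ : ∀ {x y z} → X ∋ x → X ∋ y → X ∋ z → y ≢ x → z ≢ x →
    cut s t X ⊢ x ∼ y → cut s t X ⊢ x ∼ z → y ≡ z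
  ρ-unique₂ xx xy xz ny nz ry rz = trans (ρ-unique xx xy ny ry) (sym (ρ-unique xx xz nz rz))

  ρ-inv : ∀ {x} → X ∋ x → ρ (ρ x) ≡ x
  ρ-inv xx = sym (ρ-unique (ρ-in xx) xx (≢-sym (ρ-≢ xx)) (sym (ρ-∼ xx)))

-- Euler's inequality v + f ≤ e + 2 k, by switching the edges from t2 to t0 one at a time

record EdgePair (t0 t2 : Fin n → Fin n) : Set where
  field
    inv0 : FPFInvolution t0
    inv2 : FPFInvolution t2
    comm : ∀ x → t0 (t2 x) ≡ t2 (t0 x)
    diff : ∀ x → t0 x ≢ t2 x

module Euler {n : ℕ} (t0 t1 t2 : Fin n → Fin n) (E : EdgePair t0 t2) (T1 : FPFInvolution t1) where
  open EdgePair E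

  t00 = proj₁ inv0
  t22 = proj₁ inv2

  edges : Part n
  edges = gen (t0 ∷ t2 ∷ [])

  -- Boundary components of the spanning ribbon subgraph with edge set `A`: an edge in `A` is
  -- followed along its side, any other edge is skipped across its end. Likewise `comps A` gives the
  -- components of that subgraph.
  curves : Subset n → Part n
  curves A = gen (t1 ∷ mix A t0 t2 ∷ [])

  comps : Subset n → Part n
  comps A = gen (t1 ∷ t2 ∷ mix A t0 id ∷ [])

  -- Euler's inequality for the spanning subgraph on `A`. For empty `A` each vertex is one curve and
  -- one component; for full `A` the curves are the faces.
  Inv : Subset n → Set
  Inv A = count (curves A) + count (gen (t1 ∷ t2 ∷ []))
          ≤ 2 * count (comps A) + card (λ z → fix edges z ∧ A z)

  module Add (A : Subset n) (A0 : Invariant A t0) (A2 : Invariant A t2)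
    (x : Fin n) (x∉A : A x ≡ false) where

    quad : List (Fin n)
    quad = x ∷ t0 x ∷ t2 x ∷ t0 (t2 x) ∷ []

    Q A′ : Subset n
    Q = oneOf quad
    A′ z = A z ∨ Q z

    Q∌A : ∀ {z} → z ∈ quad → A z ≡ false
    Q∌A 0th = x∉A
    Q∌A 1st = trans (A0 _) x∉A
    Q∌A 2nd = trans (A2 _) x∉A
    Q∌A 3rd = trans (A0 _) (trans (A2 _) x∉A)

    Q-t0 : ∀ {z} → z ∈ quad → t0 z ∈ quad
    Q-t0 0th = 1st
    Q-t0 1st = here (t00 x)
    Q-t0 2nd = 3rd
    Q-t0 3rd = there (there (here (t00 (t2 x))))

    Q-t2 : ∀ {z} → z ∈ quad → t2 z ∈ quad
    Q-t2 0th = 2nd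
    Q-t2 1st = there (there (there (here (sym (comm x)))))
    Q-t2 2nd = here (t22 x)
    Q-t2 3rd = there (here (trans (sym (comm _)) (cong t0 (t22 x))))

    Q-invariant : (t : Fin n → Fin n) → (∀ z → t (t z) ≡ z) → (∀ {z} → z ∈ quad → t z ∈ quad) → Invariant Q t
    Q-invariant t tt h z = ⇔⇒≡ _ _
      (λ e → subst (Q ∋_) (tt z) (oneOf-intro (h (oneOf-elim quad e))))
      (λ e → oneOf-intro (h (oneOf-elim quad e)))

    A′0 : Invariant A′ t0
    A′0 z = cong₂ _∨_ (A0 z) (Q-invariant t0 t00 Q-t0 z)
    A′2 : Invariant A′ t2
    A′2 z = cong₂ _∨_ (A2 z) (Q-invariant t2 t22 Q-t2 z)

    A⊆A′ : ∀ z → A ∋ z → A′ ∋ z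
    A⊆A′ z e rewrite e = refl

    Q⊆A′ : ∀ z → Q ∋ z → A′ ∋ z
    Q⊆A′ z e = trans (cong (A z ∨_) e) (∨-zeroʳ (A z))

    x∈A′ : A′ ∋ x
    x∈A′ = Q⊆A′ x (oneOf-intro {xs = quad} 0th)

    s = mix A t0 t2
    -- The arcs left when the edge of `x` is cut out. `curves A` closes them up along `t2` at the
    -- four corners, `curves A′` along `t0`.
    R = cut s t1 Q

    s-quad : ∀ {z} → z ∈ quad → s z ≡ t2 z
    s-quad i = mix-false A (Q∌A i)

    open FirstReturn s t1 (mix-involution A0 A2 inv0 inv2) T1 Q
      (λ z e → oneOf-intro (subst (_∈ quad) (sym (s-quad (oneOf-elim quad e))) (Q-t2 (oneOf-elim quad e))))

    in0 = oneOf-intro {xs = quad} {x} 0th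
    in1 = oneOf-intro {xs = quad} {t0 x} 1st
    in3 = oneOf-intro {xs = quad} {t0 (t2 x)} 3rd

    3≢0 : t0 (t2 x) ≢ x
    3≢0 e = diff x (sym (trans (sym (t00 _)) (cong t0 e)))
    3≢1 : t0 (t2 x) ≢ t0 x
    3≢1 e = proj₂ inv2 x (trans (sym (t00 _)) (trans (cong t0 e) (t00 x)))

    curves⊑ : (p : Part n) → R ⊑ p → p ⊢ x ∼ t2 x → p ⊢ t0 x ∼ t0 (t2 x) → curves A ⊑ p
    curves⊑ p h e02 e13 = gen-⊑ _ p ((λ z → h (gen-∼ 0th z)) ∷ step ∷ [])
      where
      quad-step : ∀ {z} → z ∈ quad → p ⊢ z ∼ t2 z
      quad-step 0th = e02
      quad-step 1st = trans e13 (cong (cls p) (comm x))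
      quad-step 2nd = trans (sym e02) (cong (cls p) (sym (t22 x)))
      quad-step 3rd = trans (sym e13) (cong (cls p) (trans (cong t0 (sym (t22 x))) (comm _)))
      step : ∀ z → p ⊢ z ∼ s z
      step z with true? (Q z)
      ... | inj₁ e = trans (quad-step (oneOf-elim quad e)) (cong (cls p) (sym (s-quad (oneOf-elim quad e))))
      ... | inj₂ e = trans (h (gen-∼ 1st z)) (cong (cls p) (mix-false Q e))

    R⊑curves′ : R ⊑ curves A′
    R⊑curves′ = gen-⊑ _ (curves A′) (gen-∼ 0th ∷ step ∷ [])
      where
      same : ∀ z → Q z ≡ false → mix A′ t0 t2 z ≡ s z
      same z e with true? (A z)
      ... | inj₁ e′ = trans (mix-true A′ (A⊆A′ z e′)) (sym (mix-true A e′))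
      ... | inj₂ e′ = trans (mix-false A′ (cong₂ _∨_ e′ e)) (sym (mix-false A e′))
      step : ∀ z → curves A′ ⊢ z ∼ off s Q z
      step z with true? (Q z)
      ... | inj₁ e = cong (cls (curves A′)) (sym (mix-true Q e))
      ... | inj₂ e = trans (gen-∼ 1st z) (cong (cls (curves A′)) (trans
              (same z e)
              (sym (mix-false Q e))))

    x∼t0x : curves A′ ⊢ x ∼ t0 x
    x∼t0x = trans (gen-∼ 1st x) (cong (cls (curves A′)) (mix-true A′ x∈A′))

    -- The four corners lie in at most two classes of R, so closing x up with t2 x closes up the other pair.
    paired : merge R x (t2 x) ⊢ t0 x ∼ t0 (t2 x)
    paired = go (oneOf-elim quad (ρ-in in1)) refl
      where
      p = merge R x (t2 x)
      up = merge-⊒ R x (t2 x)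
      e02 = merge-∼ R x (t2 x)
      not3 : ∀ {z} → ρ (t0 x) ≡ z → t0 (t2 x) ≢ z → ¬ (R ⊢ t0 x ∼ t0 (t2 x))
      not3 e ne r = ne (trans (ρ-unique in1 in3 3≢1 r) e)
      go : ∀ {z} → z ∈ quad → ρ (t0 x) ≡ z → p ⊢ t0 x ∼ t0 (t2 x)
      other : ∀ {z} → z ∈ quad → ρ (t0 (t2 x)) ≡ z → ¬ (R ⊢ t0 x ∼ t0 (t2 x)) →
        ρ (t0 x) ≡ x ⊎ ρ (t0 x) ≡ t2 x → p ⊢ t0 x ∼ t0 (t2 x)
      go 0th e = other (oneOf-elim quad (ρ-in in3)) refl (not3 e 3≢0) (inj₁ e)
      go 1st e = ⊥-elim (ρ-≢ in1 e)
      go 2nd e = other (oneOf-elim quad (ρ-in in3)) refl (not3 e (proj₂ inv0 (t2 x))) (inj₂ e)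
      go 3rd e = up (trans (ρ-∼ in1) (cong (cls R) e))
      other 1st e nr _ = ⊥-elim (nr (sym (trans (ρ-∼ in3) (cong (cls R) e))))
      other 3rd e nr _ = ⊥-elim (ρ-≢ in3 e)
      other 0th e nr (inj₁ e′) = up (trans (trans (ρ-∼ in1) (cong (cls R) e′)) (sym (trans (ρ-∼ in3) (cong (cls R) e))))
      other 0th e nr (inj₂ e′) = trans (up (trans (ρ-∼ in1) (cong (cls R) e′))) (trans (sym e02) (sym (up (trans (ρ-∼ in3) (cong (cls R) e)))))
      other 2nd e nr (inj₁ e′) = trans (up (trans (ρ-∼ in1) (cong (cls R) e′))) (trans e02 (sym (up (trans (ρ-∼ in3) (cong (cls R) e)))))
      other 2nd e nr (inj₂ e′) = up (trans (trans (ρ-∼ in1) (cong (cls R) e′)) (sym (trans (ρ-∼ in3) (cong (cls R) e))))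

    curves′≤ : count (curves A′) ≤ suc (count (curves A))
    curves′≤ = ≤-trans (count-mono R⊑curves′) (≤-trans (merge-count-≤ R x (t2 x))
      (s≤s (count-mono (curves⊑ (merge R x (t2 x)) (merge-⊒ R x (t2 x)) (merge-∼ R x (t2 x)) paired))))

    comps′⊑ : (p : Part n) → comps A ⊑ p → p ⊢ x ∼ t0 x → comps A′ ⊑ p
    comps′⊑ p h e01 = gen-⊑ _ p ((λ z → h (gen-∼ 0th z)) ∷ (λ z → h (gen-∼ 1st z)) ∷ step ∷ [])
      where
      e02 : p ⊢ x ∼ t2 x
      e02 = h (gen-∼ 1st x)
      e13 : p ⊢ t0 x ∼ t0 (t2 x)
      e13 = trans (h (gen-∼ 1st (t0 x))) (cong (cls p) (sym (comm x)))
      quad-step : ∀ {z} → z ∈ quad → p ⊢ z ∼ t0 z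
      quad-step 0th = e01
      quad-step 1st = trans (sym e01) (cong (cls p) (sym (t00 x)))
      quad-step 2nd = trans (sym e02) (trans e01 e13)
      quad-step 3rd = trans (sym e13) (trans (sym e01) (trans e02 (cong (cls p) (sym (t00 _)))))
      step : ∀ z → p ⊢ z ∼ mix A′ t0 id z
      step z with true? (Q z) | true? (A z)
      ... | inj₁ e | _ = trans (quad-step (oneOf-elim quad e)) (cong (cls p) (sym (mix-true A′ (Q⊆A′ z e))))
      ... | inj₂ _ | inj₁ e = trans (h (gen-∼ 2nd z)) (cong (cls p) (trans (mix-true A e) (sym (mix-true A′ (A⊆A′ z e)))))
      ... | inj₂ e | inj₂ e′ = cong (cls p) (sym (mix-false A′ (cong₂ _∨_ e′ e)))

    R⊑comps : R ⊑ comps A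
    R⊑comps = gen-⊑ _ (comps A) (gen-∼ 0th ∷ step ∷ [])
      where
      step : ∀ z → comps A ⊢ z ∼ off s Q z
      step z with true? (Q z) | true? (A z)
      ... | inj₁ e | _ = cong (cls (comps A)) (sym (mix-true Q e))
      ... | inj₂ e | inj₁ e′ = trans (gen-∼ 2nd z) (cong (cls (comps A)) (trans (mix-true A e′) (sym (trans (mix-false Q e) (mix-true A e′)))))
      ... | inj₂ e | inj₂ e′ = trans (gen-∼ 1st z) (cong (cls (comps A)) (sym (trans (mix-false Q e) (mix-false A e′))))

    -- Arcs stay inside a component, so they pair `x` with `t2 x` and `t0 x` with `t0 (t2 x)`. Hence
    -- closing up along `t2` merges no arcs, whereas closing up along `t0` merges two different
    -- ones.
    bridge : ¬ (comps A ⊢ x ∼ t0 x) → suc (count (curves A′)) ≤ count (curves A)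
    bridge nr = ≤-trans (s≤s (count-mono sub))
      (≤-trans (merge-count-< R x (t0 x) (λ r → nr (R⊑comps r)))
        (count-mono (curves⊑ R id (at0 (oneOf-elim quad (ρ-in in0)) refl) (at1 (oneOf-elim quad (ρ-in in1)) refl))))
      where
      k02 : comps A ⊢ x ∼ t2 x
      k02 = gen-∼ 1st x
      k13 : comps A ⊢ t0 x ∼ t0 (t2 x)
      k13 = trans (gen-∼ 1st (t0 x)) (cong (cls (comps A)) (sym (comm x)))
      sub : merge R x (t0 x) ⊑ curves A′
      sub = merge-elim R x (t0 x) (∼-equiv (curves A′)) R⊑curves′ x∼t0x
      R0 : ∀ {z} → ρ x ≡ z → R ⊢ x ∼ z
      R0 e = trans (ρ-∼ in0) (cong (cls R) e)
      R1 : ∀ {z} → ρ (t0 x) ≡ z → R ⊢ t0 x ∼ z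
      R1 e = trans (ρ-∼ in1) (cong (cls R) e)
      at0 : ∀ {z} → z ∈ quad → ρ x ≡ z → R ⊢ x ∼ t2 x
      at0 0th e = ⊥-elim (ρ-≢ in0 e)
      at0 1st e = ⊥-elim (nr (R⊑comps (R0 e)))
      at0 2nd e = R0 e
      at0 3rd e = ⊥-elim (nr (trans (R⊑comps (R0 e)) (sym k13)))
      at1 : ∀ {z} → z ∈ quad → ρ (t0 x) ≡ z → R ⊢ t0 x ∼ t0 (t2 x)
      at1 0th e = ⊥-elim (nr (sym (R⊑comps (R1 e))))
      at1 1st e = ⊥-elim (ρ-≢ in1 e)
      at1 2nd e = ⊥-elim (nr (sym (trans (R⊑comps (R1 e)) (sym k02))))
      at1 3rd e = R1 e

    edges< : suc (card (λ z → fix edges z ∧ A z)) ≤ card (λ z → fix edges z ∧ A′ z)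
    edges< = card-strict (cls edges x)
      (λ z e → ∧-intro (∧-fst (fix edges z) e) (A⊆A′ z (∧-snd (fix edges z) e)))
      (trans (cong (fix edges (cls edges x) ∧_) (trans (const-on-edge A A0 A2) x∉A)) (∧-zeroʳ _))
      (∧-intro (fix-cls edges x) (trans (const-on-edge A′ A′0 A′2) x∈A′))
      where
      const-on-edge : (B : Subset n) → Invariant B t0 → Invariant B t2 → B (cls edges x) ≡ B x
      const-on-edge B b0 b2 = gen-elim _ (≡-on B) ((λ z → sym (b0 z)) ∷ (λ z → sym (b2 z)) ∷ []) (idem edges x)

    -- If the new edge joins a component to itself, it pays for the one curve that may appear. If it
    -- joins two components, the right side loses 2 and gains 1 for the edge, and the lost curve
    -- makes up the difference.
    add : Inv A → Inv A′
    add inv with cls (comps A) x ≟ cls (comps A) (t0 x)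
    ... | yes r = begin
      count (curves A′) + v               ≤⟨ +-monoˡ-≤ v curves′≤ ⟩
      suc (count (curves A) + v)          ≤⟨ s≤s inv ⟩
      suc (2 * count (comps A) + _)       ≡⟨ +-suc (2 * count (comps A)) _ ⟨
      2 * count (comps A) + suc _         ≤⟨ +-mono-≤ (*-monoʳ-≤ 2 (count-mono (comps′⊑ (comps A) id r))) edges< ⟩
      2 * count (comps A′) + _            ∎
      where
      open ≤-Reasoning
      v = count (gen (t1 ∷ t2 ∷ []))
    ... | no nr = ≤-pred (begin
      suc (count (curves A′)) + v               ≤⟨ +-monoˡ-≤ v (bridge nr) ⟩
      count (curves A) + v                      ≤⟨ inv ⟩
      2 * count (comps A) + e                   ≤⟨ +-monoˡ-≤ e (*-monoʳ-≤ 2 (≤-trans (merge-count-≤ (comps A) x (t0 x)) (s≤s (count-mono (comps′⊑ (merge (comps A) x (t0 x)) (merge-⊒ (comps A) x (t0 x)) (merge-∼ (comps A) x (t0 x))))))) ⟩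
      2 * suc (count (comps A′)) + e            ≡⟨ cong (_+ e) (*-suc 2 (count (comps A′))) ⟩
      suc (suc (2 * count (comps A′) + e))      ≡⟨ cong suc (+-suc (2 * count (comps A′)) e) ⟨
      suc (2 * count (comps A′) + suc e)        ≤⟨ s≤s (+-monoʳ-≤ (2 * count (comps A′)) edges<) ⟩
      suc (2 * count (comps A′) + _)            ∎)
      where
      open ≤-Reasoning
      v = count (gen (t1 ∷ t2 ∷ []))
      e = card (λ z → fix edges z ∧ A z)

  euler : count (gen (t2 ∷ t1 ∷ [])) + count (gen (t0 ∷ t1 ∷ [])) ≤ count edges + 2 * count (gen (t1 ∷ t0 ∷ t2 ∷ []))
  euler = loop (card {n} (const true)) (const false) (λ _ → refl) (λ _ → refl) start ≤-refl
    where
    Goal = count (gen (t2 ∷ t1 ∷ [])) + count (gen (t0 ∷ t1 ∷ [])) ≤ count edges + 2 * count (gen (t1 ∷ t0 ∷ t2 ∷ []))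
    start : Inv (const false)
    start = ≤-trans (≤-trans (+-mono-≤
       (count-mono (gen-⊑ _ (curves (const false)) (gen-∼ 0th ∷ (λ z → trans (gen-∼ 1st z) (cong (cls (curves (const false))) (mix-false (const false) refl))) ∷ [])))
       ≤-refl) (≤-trans (≤-reflexive (cong (c +_) (sym (+-identityʳ c))))
       (*-monoʳ-≤ 2 (count-mono (gen-⊑ _ (gen (t1 ∷ t2 ∷ [])) (gen-∼ 0th ∷ gen-∼ 1st ∷ (λ z → cong (cls (gen (t1 ∷ t2 ∷ []))) (sym (mix-false (const false) refl))) ∷ []))))))
       (m≤m+n _ _)
      where c = count (gen (t1 ∷ t2 ∷ []))
    finish : ∀ A → (∀ z → A ∋ z) → Inv A → Goal
    finish A all inv = begin
      count (gen (t2 ∷ t1 ∷ [])) + count (gen (t0 ∷ t1 ∷ []))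
        ≡⟨ +-comm (count (gen (t2 ∷ t1 ∷ []))) _ ⟩
      count (gen (t0 ∷ t1 ∷ [])) + count (gen (t2 ∷ t1 ∷ []))
        ≤⟨ +-mono-≤ (count-mono (gen-⊑ _ (gen (t0 ∷ t1 ∷ [])) (gen-∼ 1st ∷ (λ z → trans (gen-∼ 0th z) (cong (cls (gen (t0 ∷ t1 ∷ []))) (sym (mix-true A (all z))))) ∷ [])))
                    (count-mono (gen-⊑ _ (gen (t2 ∷ t1 ∷ [])) (gen-∼ 1st ∷ gen-∼ 0th ∷ []))) ⟩
      count (curves A) + count (gen (t1 ∷ t2 ∷ []))
        ≤⟨ inv ⟩
      2 * count (comps A) + card (λ z → fix edges z ∧ A z)
        ≤⟨ +-mono-≤ (*-monoʳ-≤ 2 (count-mono (gen-⊑ _ (comps A) (gen-∼ 0th ∷ (λ z → trans (gen-∼ 2nd z) (cong (cls (comps A)) (mix-true A (all z)))) ∷ gen-∼ 1st ∷ []))))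
                    (≤-trans (card-mono (λ z → ∧-fst (fix edges z))) (≤-reflexive (sym (count-def edges)))) ⟩
      2 * count (gen (t1 ∷ t0 ∷ t2 ∷ [])) + count edges
        ≡⟨ +-comm _ (count edges) ⟩
      count edges + 2 * count (gen (t1 ∷ t0 ∷ t2 ∷ [])) ∎
      where open ≤-Reasoning
    loop : ∀ k A → Invariant A t0 → Invariant A t2 → Inv A → card (not ∘ A) ≤ k → Goal
    loop k A A0 A2 inv l with decide (not ∘ A)
    ... | inj₂ none = finish A (λ z → not-false (none z)) inv
      where
      not-false : {b : Bool} → not b ≡ false → b ≡ true
      not-false {true} _ = refl
    ... | inj₁ (x , e) with ≤-trans less l
      where
      open Add A A0 A2 x (not-true e)
      less : suc (card (not ∘ A′)) ≤ card (not ∘ A)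
      less = card-strict x (λ z e′ → cong not (¬-not λ a → true≢false (A⊆A′ z a) (not-true e′))) (cong not x∈A′) e
    loop (suc k) A A0 A2 inv l | inj₁ (x , e) | s≤s l′ =
      loop k (Add.A′ A A0 A2 x (not-true e)) (Add.A′0 A A0 A2 x (not-true e)) (Add.A′2 A A0 A2 x (not-true e))
        (Add.add A A0 A2 x (not-true e) inv) l′

-- Reconnecting c - s c and c′ - s c′ to c - c′ and s c - s c′

module Switch {n : ℕ} (s : Fin n → Fin n) (S : FPFInvolution s)
  (c c′ : Fin n) (c′≢c : c′ ≢ c) (c′≢d : c′ ≢ s c) where

  ss = proj₁ S

  d d′ : Fin n
  d = s c
  d′ = s c′

  ends : List (Fin n)
  ends = c ∷ c′ ∷ d ∷ d′ ∷ []

  X : Subset n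
  X = oneOf ends

  d≢c : d ≢ c
  d≢c = proj₂ S c
  d′≢c′ : d′ ≢ c′
  d′≢c′ = proj₂ S c′
  d′≢c : d′ ≢ c
  d′≢c e = c′≢d (trans (sym (ss c′)) (cong s e))
  d′≢d : d′ ≢ d
  d′≢d e = c′≢c (trans (sym (ss c′)) (trans (cong s e) (ss c)))

  abstract
    s′ : Fin n → Fin n
    s′ z = if z == c then c′ else if z == c′ then c else if z == d then d′ else if z == d′ then d else s z

    s′c : s′ c ≡ c′
    s′c = if-true (≡⇒== {x = c} refl)
    s′c′ : s′ c′ ≡ c
    s′c′ = trans (if-false (≢⇒== c′≢c)) (if-true (≡⇒== {x = c′} refl))
    s′d : s′ d ≡ d′
    s′d = trans (if-false (≢⇒== d≢c)) (trans (if-false (≢⇒== (≢-sym c′≢d))) (if-true (≡⇒== {x = d} refl)))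
    s′d′ : s′ d′ ≡ d
    s′d′ = trans (if-false (≢⇒== d′≢c)) (trans (if-false (≢⇒== d′≢c′)) (trans (if-false (≢⇒== d′≢d)) (if-true (≡⇒== {x = d′} refl))))
    s′-off : ∀ {z} → ¬ (z ∈ ends) → s′ z ≡ s z
    s′-off h = trans (if-false (≢⇒== (λ e → h (here e)))) (trans (if-false (≢⇒== (λ e → h (there (here e)))))
      (trans (if-false (≢⇒== (λ e → h (there (there (here e)))))) (if-false (≢⇒== (λ e → h (there (there (there (here e)))))))))

  X⇒∈ : ∀ {z} → X ∋ z → z ∈ ends
  X⇒∈ = oneOf-elim ends

  X̸⇒∉ : ∀ {z} → X z ≡ false → ¬ (z ∈ ends)
  X̸⇒∉ e i = true≢false (oneOf-intro i) e

  ends-s : ∀ {z} → z ∈ ends → s z ∈ ends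
  ends-s 0th = 2nd
  ends-s 1st = 3rd
  ends-s 2nd = here (ss c)
  ends-s 3rd = there (here (ss c′))

  s′-involution : FPFInvolution s′
  s′-involution = inv , ne
    where
    inv-in : ∀ {z} → z ∈ ends → s′ (s′ z) ≡ z
    inv-in 0th = trans (cong s′ s′c) s′c′
    inv-in 1st = trans (cong s′ s′c′) s′c
    inv-in 2nd = trans (cong s′ s′d) s′d′
    inv-in 3rd = trans (cong s′ s′d′) s′d
    inv : ∀ z → s′ (s′ z) ≡ z
    inv z with true? (X z)
    ... | inj₁ e = inv-in (X⇒∈ e)
    ... | inj₂ e = trans (cong s′ (s′-off (X̸⇒∉ e)))
          (trans (s′-off (λ i → X̸⇒∉ e (subst (_∈ ends) (ss z) (ends-s i)))) (ss z))
    ne-in : ∀ {z} → z ∈ ends → s′ z ≢ z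
    ne-in 0th e = c′≢c (trans (sym s′c) e)
    ne-in 1st e = c′≢c (sym (trans (sym s′c′) e))
    ne-in 2nd e = d′≢d (trans (sym s′d) e)
    ne-in 3rd e = d′≢d (sym (trans (sym s′d′) e))
    ne : ∀ z → s′ z ≢ z
    ne z e with true? (X z)
    ... | inj₁ x = ne-in (X⇒∈ x) e
    ... | inj₂ x = proj₂ S z (trans (sym (s′-off (X̸⇒∉ x))) e)

  s-⊑ : (p : Part n) → (∀ z → X z ≡ false → p ⊢ z ∼ s z) → p ⊢ c ∼ d → p ⊢ c′ ∼ d′ → ∀ z → p ⊢ z ∼ s z
  s-⊑ p h e e′ z with true? (X z)
  ... | inj₂ x = h z x
  ... | inj₁ x = go (X⇒∈ x)
    where
    go : ∀ {z} → z ∈ ends → p ⊢ z ∼ s z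
    go 0th = e
    go 1st = e′
    go 2nd = trans (sym e) (cong (cls p) (sym (ss c)))
    go 3rd = trans (sym e′) (cong (cls p) (sym (ss c′)))

  s′-⊑ : (p : Part n) → (∀ z → X z ≡ false → p ⊢ z ∼ s z) → p ⊢ c ∼ c′ → p ⊢ d ∼ d′ → ∀ z → p ⊢ z ∼ s′ z
  s′-⊑ p h e e′ z with true? (X z)
  ... | inj₂ x = trans (h z x) (cong (cls p) (sym (s′-off (X̸⇒∉ x))))
  ... | inj₁ x = go (X⇒∈ x)
    where
    go : ∀ {z} → z ∈ ends → p ⊢ z ∼ s′ z
    go 0th = trans e (cong (cls p) (sym s′c))
    go 1st = trans (sym e) (cong (cls p) (sym s′c′))
    go 2nd = trans e′ (cong (cls p) (sym s′d))
    go 3rd = trans (sym e′) (cong (cls p) (sym s′d′))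

  module Curves (t : Fin n → Fin n) (T : FPFInvolution t) where
    open FirstReturn s t S T X (λ x e → oneOf-intro (ends-s (X⇒∈ e))) using (ρ; ρ-in; ρ-≢; ρ-∼; ρ-unique₂)

    R : Part n
    R = cut s t X

    Xc : X ∋ c
    Xc = oneOf-intro 0th
    Xc′ : X ∋ c′
    Xc′ = oneOf-intro 1st
    Xd : X ∋ d
    Xd = oneOf-intro 2nd
    Xd′ : X ∋ d′
    Xd′ = oneOf-intro 3rd

    R-ρ : ∀ {x z} → X ∋ x → ρ x ≡ z → R ⊢ x ∼ z
    R-ρ xx e = trans (ρ-∼ xx) (cong (cls R) e)

    R-off : ∀ z → X z ≡ false → R ⊢ z ∼ s z
    R-off z e = trans (gen-∼ 1st z) (cong (cls R) (mix-false X e))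

    -- Each arc has two of the four ends, so once `c` and `c′` share an arc only `d′` is left as
    -- partner of `d`.
    cc′⇒dd′ : R ⊢ c ∼ c′ → R ⊢ d ∼ d′
    cc′⇒dd′ r = go (X⇒∈ (ρ-in Xd)) refl
      where
      apart : ¬ (R ⊢ c ∼ d)
      apart r′ = c′≢d (ρ-unique₂ Xc Xc′ Xd c′≢c d≢c r r′)
      go : ∀ {z} → z ∈ ends → ρ d ≡ z → R ⊢ d ∼ d′
      go 0th e = ⊥-elim (apart (sym (R-ρ Xd e)))
      go 1st e = ⊥-elim (apart (trans r (sym (R-ρ Xd e))))
      go 2nd e = ⊥-elim (ρ-≢ Xd e)
      go 3rd e = R-ρ Xd e

    dd′⇒cc′ : R ⊢ d ∼ d′ → R ⊢ c ∼ c′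
    dd′⇒cc′ r = go (X⇒∈ (ρ-in Xc)) refl
      where
      apart : ¬ (R ⊢ d ∼ c)
      apart r′ = d′≢c (ρ-unique₂ Xd Xd′ Xc d′≢d (≢-sym d≢c) r r′)
      go : ∀ {z} → z ∈ ends → ρ c ≡ z → R ⊢ c ∼ c′
      go 0th e = ⊥-elim (ρ-≢ Xc e)
      go 1st e = R-ρ Xc e
      go 2nd e = ⊥-elim (apart (sym (R-ρ Xc e)))
      go 3rd e = ⊥-elim (apart (trans r (sym (R-ρ Xc e))))

    -- The two arcs, from `c` to `c′` and from `d` to `d′`, form a single curve under `s`, while
    -- `s′` closes each of them separately.
    splits : R ⊢ c ∼ c′ → suc (count (gen (t ∷ s ∷ []))) ≤ count (gen (t ∷ s′ ∷ []))
    splits r = ≤-trans (s≤s (count-mono sub))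
      (≤-trans (merge-count-< R c d (λ r′ → c′≢d (ρ-unique₂ Xc Xc′ Xd c′≢c d≢c r r′)))
        (count-mono (gen-⊑ _ R (gen-∼ 0th ∷ s′-⊑ R R-off r (cc′⇒dd′ r) ∷ []))))
      where
      sub : merge R c d ⊑ gen (t ∷ s ∷ [])
      sub = merge-elim R c d (∼-equiv (gen (t ∷ s ∷ []))) (cut-⊑ s t X) (gen-∼ 1st c)

    -- Arcs between the four ends stay inside classes of `p`, and `s′` ties `d′` to `d`. If `d` is
    -- in another class than `c`, the arc from `c` can only end at `c′`.
    separated : (p : Part n) → (∀ z → p ⊢ z ∼ t z) → (∀ z → p ⊢ z ∼ s′ z) → ¬ (p ⊢ c ∼ d) → R ⊢ c ∼ c′
    separated p ht hs′ apart = go (X⇒∈ (ρ-in Xc)) refl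
      where
      step : ∀ z → p ⊢ z ∼ off s X z
      step z with true? (X z)
      ... | inj₁ e = cong (cls p) (sym (mix-true X e))
      ... | inj₂ e = trans (hs′ z) (cong (cls p) (trans (s′-off (X̸⇒∉ e)) (sym (mix-false X e))))
      R⊑p : R ⊑ p
      R⊑p = gen-⊑ _ p (ht ∷ step ∷ [])
      go : ∀ {z} → z ∈ ends → ρ c ≡ z → R ⊢ c ∼ c′
      go 0th e = ⊥-elim (ρ-≢ Xc e)
      go 1st e = R-ρ Xc e
      go 2nd e = ⊥-elim (apart (R⊑p (R-ρ Xc e)))
      go 3rd e = ⊥-elim (apart (trans (R⊑p (R-ρ Xc e)) (trans (hs′ d′) (cong (cls p) s′d′))))

-- Crossings of an edge set, and the count when no pairings agree

xor-true : (a b : Bool) → a xor b ≡ true → b ≡ not a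
xor-true true false _ = refl
xor-true false true _ = refl

xor-false : (a b : Bool) → a xor b ≡ false → b ≡ a
xor-false true true _ = refl
xor-false false false _ = refl

xor-intro : {a b : Bool} → b ≡ not a → a xor b ≡ true
xor-intro {true} refl = refl
xor-intro {false} refl = refl

-- Suffixes N and M mark classes missing and meeting the crossing set, hats mark the system with
-- `ŝ`, `n2`, `m2`, `n0` count pieces of the cut-open curves, and `w` counts hatted faces meeting
-- the set. With x for its size, vM + fM ≤ x/4, m2 ≥ x/2 and w ≤ x/4. Each hatted component meeting
-- the set contains such a face, so Euler's inequality gives n2 + x/2 + n0 + w ≤ e + 2kN + 2w,
-- whence v + f ≤ e + 2kN ≤ e + 2k - 2, against `lo`. Everything is multiplied by 4 to clear the
-- fractions.
counting-contradiction : {e k v f vN vM fN fM n2 n0 m2 v̂ f̂ f̂N w k̂ k̂N k̂M kN kM N X : ℕ} →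
  v ≡ vN + vM → f ≡ fN + fM → k ≡ kN + kM → k̂ ≡ k̂N + k̂M → f̂ ≡ f̂N + w →
  vN ≤ n2 → fN ≤ n0 → n2 + m2 ≤ v̂ → n0 ≤ f̂N → k̂N ≤ kN → k̂M ≤ w → 1 ≤ kM →
  4 * vM ≤ N → 4 * fM ≤ N → N + N ≤ X → X ≤ 2 * m2 → 4 * w ≤ X →
  v̂ + f̂ ≤ e + 2 * k̂ → e + 2 * k ≤ suc (v + f) → ⊥
counting-contradiction {e} {k} {v} {f} {vN} {vM} {fN} {fM} {n2} {n0} {m2} {v̂} {f̂} {f̂N} {w} {k̂} {k̂N} {k̂M} {kN} {kM} {N} {X}
  refl refl refl refl refl a1 a2 a3 a4 a5 a6 a7 b1 b2 b3 b4 b5 eu lo =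
  8≰4 (+-cancelʳ-≤ T 8 4 (≤-trans lower upper))
  where
  open ≤-Reasoning
  open +-*-Solver
  T = 4 * e + 8 * kN
  8≰4 : ¬ (8 ≤ 4)
  8≰4 (s≤s (s≤s (s≤s (s≤s ()))))
  lower : 8 + T ≤ 4 * (e + 2 * (kN + kM))
  lower = begin
    8 + (4 * e + 8 * kN)       ≡⟨ solve 2 (λ e k → con 8 :+ (con 4 :* e :+ con 8 :* k) := con 4 :* (e :+ con 2 :* (k :+ con 1))) refl e kN ⟩
    4 * (e + 2 * (kN + 1))     ≤⟨ *-monoʳ-≤ 4 (+-monoʳ-≤ e (*-monoʳ-≤ 2 (+-monoʳ-≤ kN a7))) ⟩
    4 * (e + 2 * (kN + kM))    ∎
  -- `X + 4 * w` is added to both sides and cancelled, which replaces subtraction in ℕ.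
  main : 4 * (n2 + n0) + X ≤ T
  main = +-cancelʳ-≤ (X + 4 * w) _ _ (begin
    4 * (n2 + n0) + X + (X + 4 * w)      ≡⟨ solve 4 (λ a b x w → con 4 :* (a :+ b) :+ x :+ (x :+ con 4 :* w) := con 4 :* a :+ con 2 :* x :+ con 4 :* (b :+ w)) refl n2 n0 X w ⟩
    4 * n2 + 2 * X + 4 * (n0 + w)        ≤⟨ +-mono-≤ (+-monoʳ-≤ (4 * n2) (*-monoʳ-≤ 2 b4)) (*-monoʳ-≤ 4 (+-monoˡ-≤ w a4)) ⟩
    4 * n2 + 2 * (2 * m2) + 4 * (f̂N + w) ≡⟨ solve 3 (λ a m f → con 4 :* a :+ con 2 :* (con 2 :* m) :+ con 4 :* f := con 4 :* (a :+ m :+ f)) refl n2 m2 (f̂N + w) ⟩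
    4 * (n2 + m2 + (f̂N + w))             ≤⟨ *-monoʳ-≤ 4 (≤-trans (+-monoˡ-≤ _ a3) eu) ⟩
    4 * (e + 2 * (k̂N + k̂M))              ≤⟨ *-monoʳ-≤ 4 (+-monoʳ-≤ e (*-monoʳ-≤ 2 (+-mono-≤ a5 a6))) ⟩
    4 * (e + 2 * (kN + w))               ≡⟨ solve 3 (λ e k w → con 4 :* (e :+ con 2 :* (k :+ w)) := con 4 :* e :+ con 8 :* k :+ (con 4 :* w :+ con 4 :* w)) refl e kN w ⟩
    T + (4 * w + 4 * w)                  ≤⟨ +-monoʳ-≤ T (+-monoˡ-≤ (4 * w) b5) ⟩
    T + (X + 4 * w)                      ∎)
  upper : 4 * (e + 2 * (kN + kM)) ≤ 4 + T
  upper = begin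
    4 * (e + 2 * (kN + kM))              ≤⟨ *-monoʳ-≤ 4 lo ⟩
    4 * suc (vN + vM + (fN + fM))        ≡⟨ solve 4 (λ a b c d → con 4 :* (con 1 :+ (a :+ b :+ (c :+ d))) := con 4 :+ (con 4 :* (a :+ c) :+ (con 4 :* b :+ con 4 :* d))) refl vN vM fN fM ⟩
    4 + (4 * (vN + fN) + (4 * vM + 4 * fM)) ≤⟨ +-monoʳ-≤ 4 (+-mono-≤ (*-monoʳ-≤ 4 (+-mono-≤ a1 a2)) (≤-trans (+-mono-≤ b1 b2) b3)) ⟩
    4 + (4 * (n2 + n0) + X)              ≤⟨ +-monoʳ-≤ 4 main ⟩
    4 + T                                ∎

module Crossings {n : ℕ} (A : Subset n) (s : Fin n → Fin n) (S : FPFInvolution s) where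

  ss = proj₁ S

  -- `X` has both flags of each crossing, `I` only the one inside `A`.
  X I : Subset n
  X z = A z xor A (s z)
  I z = A z ∧ not (A (s z))

  Xs : ∀ z → X ∋ z → X ∋ s z
  Xs z e = trans (cong (A (s z) xor_) (cong A (ss z))) (trans (xor-comm (A (s z)) (A z)) e)

  I⇒X : ∀ z → I ∋ z → X ∋ z
  I⇒X z e = xor-intro {A z} (trans (not-true (∧-snd (A z) e)) (cong not (sym (∧-fst (A z) e))))

  X⇒I : ∀ z → X ∋ z → A ∋ z → I ∋ z
  X⇒I z e a = ∧-intro a (cong not (trans (xor-true (A z) (A (s z)) e) (cong not a)))

  X⇒Is : ∀ z → X ∋ z → A z ≡ false → I ∋ s z
  X⇒Is z e a = X⇒I (s z) (Xs z e) (trans (xor-true (A z) (A (s z)) e) (cong not a))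

  2I≤X : card I + card I ≤ card X
  2I≤X = ≤-trans (+-mono-≤ (card-inj s
      (λ z e → ∧-intro (Xs z (I⇒X z e)) (∧-snd (A z) e))
      (λ z z′ _ _ e → trans (sym (ss z)) (trans (cong s e) (ss z′))))
      (card-mono λ z e → ∧-intro (I⇒X z e) (∧-fst (A z) e)))
    (≤-reflexive (sym (card-split X A)))

  cut-A : {t : Fin n → Fin n} → Invariant A t → ∀ {x y} → cut s t X ⊢ x ∼ y → A x ≡ A y
  cut-A At = gen-elim _ (≡-on A) ((λ z → sym (At z)) ∷ step ∷ [])
    where
    step : ∀ z → A z ≡ A (off s X z)
    step z with true? (X z)
    ... | inj₁ e = cong A (sym (mix-true X e))
    ... | inj₂ e = trans (sym (xor-false (A z) (A (s z)) e)) (cong A (sym (mix-false X e)))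

  module Curve (t : Fin n → Fin n) (T : FPFInvolution t) (At : Invariant A t) where
    open FirstReturn s t S T X Xs public using (ρ; ρ-in; ρ-≢; ρ-∼; ρ-only; ρ-inv)

    ρ-A : ∀ {z} → X ∋ z → A (ρ z) ≡ A z
    ρ-A e = sym (cut-A At (ρ-∼ e))

    cut⊑ : cut s t X ⊑ gen (t ∷ s ∷ [])
    cut⊑ = cut-⊑ s t X

    -- Along a curve, `ρ` leads from one flag of `I` to another by an arc inside `A`, and `β` by an
    -- arc outside `A`. As they disagree everywhere, a curve through a crossing has at least four
    -- flags of `I`.
    few : (∀ z → X ∋ z → ρ z ≢ s (ρ (s z))) → 4 * countIn (gen (t ∷ s ∷ [])) X ≤ card I
    few ne = 4*countIn≤ p X I fourX
      where
      p = gen (t ∷ s ∷ [])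
      β : Fin n → Fin n
      β z = s (ρ (s z))
      fourI : ∀ w → I ∋ w → FourIn p I w
      fourI = four ρ β
        (λ z i → trans (cong (s ∘ ρ) (ss _)) (trans (cong s (ρ-inv (Xs z (I⇒X z i)))) (ss z)))
        (λ z i → X⇒I (ρ z) (ρ-in (I⇒X z i)) (trans (ρ-A (I⇒X z i)) (∧-fst (A z) i)))
        (λ z i → X⇒Is (ρ (s z)) (ρ-in (Xs z (I⇒X z i))) (trans (ρ-A (Xs z (I⇒X z i))) (not-true (∧-snd (A z) i))))
        (λ z i → cut⊑ (ρ-∼ (I⇒X z i)))
        (λ z i → trans (gen-∼ 1st z) (trans (cut⊑ (ρ-∼ (Xs z (I⇒X z i)))) (gen-∼ 1st _)))
        (λ z i → ρ-≢ (I⇒X z i))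
        (λ z i e → ρ-≢ (Xs z (I⇒X z i)) (trans (sym (ss _)) (cong s e)))
        (λ z i → ne z (I⇒X z i))
      fourX : ∀ w → X ∋ w → FourIn p I w
      fourX w e with true? (A w)
      ... | inj₁ a = fourI w (X⇒I w e a)
      ... | inj₂ a = record { elt = elt ; elt-in = elt-in ; elt-inj = elt-inj ; elt-∼ = λ i → trans (elt-∼ i) (sym (gen-∼ 1st w)) }
        where open FourIn (fourI (s w) (X⇒Is w e a))

  module Agreement (t0 t2 : Fin n → Fin n) (E : EdgePair t0 t2) (A0 : Invariant A t0) (A2 : Invariant A t2) where
    open EdgePair E
    module C0 = Curve t0 inv0 A0
    module C2 = Curve t2 inv2 A2

    -- Joins the two ends of each vertex arc, so that every arc becomes a vertex of its own. A face
    -- through `X` then follows `C2.ρ` and `C0.ρ` alternately, which is what makes agreement of the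
    -- two visible as a short face.
    ŝ : Fin n → Fin n
    ŝ = mix X C2.ρ s

    ŝ-in : ∀ {z} → X ∋ z → ŝ z ≡ C2.ρ z
    ŝ-in = mix-true X

    ŝ-off : ∀ {z} → X z ≡ false → ŝ z ≡ s z
    ŝ-off = mix-false X

    ŝ-involution : FPFInvolution ŝ
    ŝ-involution = inv , ne
      where
      inv : ∀ z → ŝ (ŝ z) ≡ z
      inv z with true? (X z)
      ... | inj₁ e = trans (cong ŝ (ŝ-in e)) (trans (ŝ-in (C2.ρ-in e)) (C2.ρ-inv e))
      ... | inj₂ e = trans (cong ŝ (ŝ-off e)) (trans (ŝ-off (¬-not λ e′ → true≢false (subst (X ∋_) (ss z) (Xs (s z) e′)) e)) (ss z))
      ne : ∀ z → ŝ z ≢ z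
      ne z e′ with true? (X z)
      ... | inj₁ e = C2.ρ-≢ e (trans (sym (ŝ-in e)) e′)
      ... | inj₂ e = proj₂ S z (trans (sym (ŝ-off e)) e′)

    K K̂ : Part n
    K = gen (s ∷ t0 ∷ t2 ∷ [])
    K̂ = gen (ŝ ∷ t0 ∷ t2 ∷ [])

    V̂⊑cut : gen (t2 ∷ ŝ ∷ []) ⊑ cut s t2 X
    V̂⊑cut = gen-⊑ _ (cut s t2 X) (gen-∼ 0th ∷ step ∷ [])
      where
      step : ∀ z → cut s t2 X ⊢ z ∼ ŝ z
      step z with true? (X z)
      ... | inj₁ e = trans (C2.ρ-∼ e) (cong (cls (cut s t2 X)) (sym (ŝ-in e)))
      ... | inj₂ e = trans (gen-∼ 1st z) (cong (cls (cut s t2 X)) (trans (mix-false X e) (sym (ŝ-off e))))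

    cut⊑F̂ : cut s t0 X ⊑ gen (t0 ∷ ŝ ∷ [])
    cut⊑F̂ = gen-⊑ _ (gen (t0 ∷ ŝ ∷ [])) (gen-∼ 0th ∷ step ∷ [])
      where
      step : ∀ z → gen (t0 ∷ ŝ ∷ []) ⊢ z ∼ off s X z
      step z with true? (X z)
      ... | inj₁ e = cong (cls (gen (t0 ∷ ŝ ∷ []))) (sym (mix-true X e))
      ... | inj₂ e = trans (gen-∼ 1st z) (cong (cls (gen (t0 ∷ ŝ ∷ []))) (trans (ŝ-off e) (sym (mix-false X e))))

    -- `ŝ` maps `X` to itself and equals `s` elsewhere, so a class missing `X` does not notice the
    -- replacement. The same reason gives `offK`.
    offF̂ : countOff (cut s t0 X) X ≤ countOff (gen (t0 ∷ ŝ ∷ [])) X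
    offF̂ = countOff-mono p (gen (t0 ∷ ŝ ∷ [])) X
      (gen-elim _ (≡-on (offClass p X)) ((λ z → offClass-resp p X (gen-∼ 0th z)) ∷ step ∷ []))
      where
      p = cut s t0 X
      step : ∀ z → offClass p X z ≡ offClass p X (ŝ z)
      step z with true? (X z)
      ... | inj₁ e = trans (offClass-in p X e) (sym (offClass-in p X (subst (X ∋_) (sym (ŝ-in e)) (C2.ρ-in e))))
      ... | inj₂ e = offClass-resp p X (trans (gen-∼ 1st z) (cong (cls p) (trans (mix-false X e) (sym (ŝ-off e)))))

    offK : countOff K̂ X ≤ countOff K X
    offK = countOff-mono K̂ K X
      (gen-elim _ (≡-on (offClass K̂ X)) (step ∷ (λ z → offClass-resp K̂ X (gen-∼ 1st z)) ∷ (λ z → offClass-resp K̂ X (gen-∼ 2nd z)) ∷ []))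
      where
      step : ∀ z → offClass K̂ X z ≡ offClass K̂ X (s z)
      step z with true? (X z)
      ... | inj₁ e = trans (offClass-in K̂ X e) (sym (offClass-in K̂ X (Xs z e)))
      ... | inj₂ e = offClass-resp K̂ X (trans (gen-∼ 0th z) (cong (cls K̂) (ŝ-off e)))

    fewF̂ : (∀ z → X ∋ z → C2.ρ z ≢ C0.ρ z) → 4 * countIn (gen (t0 ∷ ŝ ∷ [])) X ≤ card X
    fewF̂ ne = 4*countIn≤ p X X (four C2.ρ C0.ρ
        (λ z e → C0.ρ-inv e) (λ z e → C2.ρ-in e) (λ z e → C0.ρ-in e)
        (λ z e → trans (gen-∼ 1st z) (cong (cls p) (ŝ-in e)))
        (λ z e → cut⊑F̂ (C0.ρ-∼ e))
        (λ z e → C2.ρ-≢ e) (λ z e → C0.ρ-≢ e) ne)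
      where p = gen (t0 ∷ ŝ ∷ [])

    disagreement : (∃ λ z → X ∋ z) →
      (∀ z → X ∋ z → C2.ρ z ≢ C0.ρ z) →
      (∀ z → X ∋ z → C2.ρ z ≢ s (C2.ρ (s z))) →
      (∀ z → X ∋ z → C0.ρ z ≢ s (C0.ρ (s z))) →
      count (gen (t0 ∷ t2 ∷ [])) + 2 * count K ≤ suc (count (gen (t2 ∷ s ∷ [])) + count (gen (t0 ∷ s ∷ []))) → ⊥
    disagreement (x , xx) n20 n2 n0 low = counting-contradiction {count (gen (t0 ∷ t2 ∷ []))}
      (count-split (gen (t2 ∷ s ∷ [])) X) (count-split (gen (t0 ∷ s ∷ [])) X) (count-split K X) (count-split K̂ X)
      (count-split (gen (t0 ∷ ŝ ∷ [])) X)
      (countOff-mono (gen (t2 ∷ s ∷ [])) (cut s t2 X) X (λ e → offClass-resp (gen (t2 ∷ s ∷ [])) X (C2.cut⊑ e)))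
      (countOff-mono (gen (t0 ∷ s ∷ [])) (cut s t0 X) X (λ e → offClass-resp (gen (t0 ∷ s ∷ [])) X (C0.cut⊑ e)))
      (≤-trans (≤-reflexive (sym (count-split (cut s t2 X) X))) (count-mono V̂⊑cut))
      offF̂ offK
      (countIn-mono (gen (t0 ∷ ŝ ∷ [])) K̂ X (gen-⊑ _ K̂ (gen-∼ 1st ∷ gen-∼ 0th ∷ [])))
      (countIn-pos K X xx)
      (C2.few n2) (C0.few n0) 2I≤X
      (card≤2*countIn (cut s t2 X) X C2.ρ (λ xx xy r → C2.ρ-only xx xy r))
      (fewF̂ n20)
      (Euler.euler t0 ŝ t2 E ŝ-involution)
      low

    agreement : (∃ λ z → X ∋ z) →
      count (gen (t0 ∷ t2 ∷ [])) + 2 * count K ≤ suc (count (gen (t2 ∷ s ∷ [])) + count (gen (t0 ∷ s ∷ []))) →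
      ∃ λ z → X ∋ z × (C2.ρ z ≡ C0.ρ z ⊎ C2.ρ z ≡ s (C2.ρ (s z)) ⊎ C0.ρ z ≡ s (C0.ρ (s z)))
    agreement x low with find (λ z → C2.ρ z) (λ z → C0.ρ z) | find C2.ρ (λ z → s (C2.ρ (s z))) | find C0.ρ (λ z → s (C0.ρ (s z)))
      where
      find : (f g : Fin n → Fin n) → (∃ λ z → X ∋ z × f z ≡ g z) ⊎ (∀ z → X ∋ z → f z ≢ g z)
      find f g with decide (λ z → X z ∧ (f z == g z))
      ... | inj₁ (z , e) = inj₁ (z , ∧-fst (X z) e , ==⇒≡ (∧-snd (X z) e))
      ... | inj₂ none = inj₂ λ z xz e → true≢false (∧-intro xz (≡⇒== e)) (none z)
    ... | inj₁ (z , xz , e) | _ | _ = z , xz , inj₁ e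
    ... | inj₂ _ | inj₁ (z , xz , e) | _ = z , xz , inj₂ (inj₁ e)
    ... | inj₂ _ | inj₂ _ | inj₁ (z , xz , e) = z , xz , inj₂ (inj₂ e)
    ... | inj₂ n20 | inj₂ n2 | inj₂ n0 = ⊥-elim (disagreement x n20 n2 n0 low)

-- Symmetric differences of edge sets with at most two crossings

module Spans {n : ℕ} (t0 t2 : Fin n → Fin n) where

  -- `u` and `w` only bound the crossings and need not be crossings themselves. This allows for sets
  -- that lose crossings when intersected with one side of another cut.
  record SmallCut (s : Fin n → Fin n) (P : Subset n) : Set where
    field
      inv0 : Invariant P t0
      inv2 : Invariant P t2
      u w  : Fin n
      only : ∀ z → P ∋ z → P (s z) ≡ false → z ≡ u ⊎ z ≡ w

  data Span (s : Fin n → Fin n) (A : Subset n) : Set where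
    none : (∀ x → A x ≡ false) → Span s A
    add  : {P B : Subset n} → SmallCut s P → Span s B → (∀ x → A x ≡ P x xor B x) → Span s A

  one : {s : Fin n → Fin n} {P : Subset n} → SmallCut s P → Span s P
  one {P = P} p = add p (none (λ _ → refl)) (λ x → sym (xor-identityʳ (P x)))

  plus : {s : Fin n → Fin n} {A B C : Subset n} → Span s A → Span s B → (∀ x → C x ≡ A x xor B x) → Span s C
  plus (none h) (none h′) e = none (λ x → trans (e x) (cong₂ _xor_ (h x) (h′ x)))
  plus (none h) (add p b h′) e = add p b (λ x → trans (e x) (trans (cong (_xor _) (h x)) (h′ x)))
  plus {B = B} (add {P} {A′} p a h) b e = add p (plus a b (λ _ → refl))
    (λ x → trans (e x) (trans (cong (_xor B x) (h x)) (xor-assoc (P x) (A′ x) (B x))))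

  -- P is one side of a two-crossing cut {c, c′} of s, and s′ reconnects c with c′ inside P.
  module Half (s s′ : Fin n → Fin n) (ss : ∀ z → s (s z) ≡ z) (ss′ : ∀ z → s′ (s′ z) ≡ z)
    (P : Subset n) (P0 : Invariant P t0) (P2 : Invariant P t2) (P′ : Invariant P s′)
    (c c′ : Fin n) (s′c : s′ c ≡ c′) (s′c′ : s′ c′ ≡ c)
    (same : ∀ z → P ∋ z → z ≢ c → z ≢ c′ → s′ z ≡ s z) where

    stays : ∀ z → P ∋ z → z ≢ c → z ≢ c′ → P ∋ s z
    stays z pz nc nc′ = trans (cong P (sym (same z pz nc nc′))) (trans (P′ z) pz)

    P-cut : SmallCut s P
    P-cut = record { inv0 = P0 ; inv2 = P2 ; u = c ; w = c′ ; only = only }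
      where
      only : ∀ z → P ∋ z → P (s z) ≡ false → z ≡ c ⊎ z ≡ c′
      only z pz e with z ≟ c | z ≟ c′
      ... | yes p | _ = inj₁ p
      ... | no _ | yes p = inj₂ p
      ... | no nc | no nc′ = ⊥-elim (true≢false (stays z pz nc nc′) e)

    ∧-false : {a b : Bool} → a ≡ true → a ∧ b ≡ false → b ≡ false
    ∧-false refl e = e

    module _ {Q : Subset n} (q : SmallCut s′ Q) where
      open SmallCut q

      -- If `c` is in `Q` then `c′` is not, so `c` is already a crossing of `Q` for `s′`; likewise
      -- with `c` and `c′` exchanged. Every crossing of the intersection for `s` is therefore one of
      -- `Q` for `s′`.
      direct : ¬ (Q ∋ c × Q ∋ c′) → SmallCut s (λ z → P z ∧ Q z)
      direct nb = record
        { inv0 = λ z → cong₂ _∧_ (P0 z) (inv0 z) ; inv2 = λ z → cong₂ _∧_ (P2 z) (inv2 z)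
        ; u = u ; w = w ; only = only′ }
        where
        only′ : ∀ z → P z ∧ Q z ≡ true → P (s z) ∧ Q (s z) ≡ false → z ≡ u ⊎ z ≡ w
        only′ z pq e with z ≟ c | z ≟ c′
        ... | yes refl | _ = only z (∧-snd (P z) pq) (¬-not λ q′ → nb (∧-snd (P z) pq , subst (Q ∋_) s′c q′))
        ... | no _ | yes refl = only z (∧-snd (P z) pq) (¬-not λ q′ → nb (subst (Q ∋_) s′c′ q′ , ∧-snd (P z) pq))
        ... | no nc | no nc′ = only z (∧-snd (P z) pq)
              (trans (cong Q (same z pz nc nc′)) (∧-false (stays z pz nc nc′) e))
          where pz = ∧-fst (P z) pq

      -- With both `c` and `c′` in `Q`, the intersection could gain these two crossings. The rest of
      -- `P` avoids them, and its crossings are partners of those of `Q`, hence the witnesses `s u`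
      -- and `s w`.
      complement : Q ∋ c → Q ∋ c′ → SmallCut s (λ z → P z ∧ not (Q z))
      complement qc qc′ = record
        { inv0 = λ z → cong₂ (λ a b → a ∧ not b) (P0 z) (inv0 z) ; inv2 = λ z → cong₂ (λ a b → a ∧ not b) (P2 z) (inv2 z)
        ; u = s u ; w = s w ; only = only′ }
        where
        only′ : ∀ z → P z ∧ not (Q z) ≡ true → P (s z) ∧ not (Q (s z)) ≡ false → z ≡ s u ⊎ z ≡ s w
        only′ z pq e with z ≟ c | z ≟ c′
        ... | yes refl | _ = ⊥-elim (true≢false qc (not-true (∧-snd (P z) pq)))
        ... | no _ | yes refl = ⊥-elim (true≢false qc′ (not-true (∧-snd (P z) pq)))
        ... | no nc | no nc′ with only (s z)
               (trans (sym (not-involutive (Q (s z)))) (cong not (∧-false (stays z (∧-fst (P z) pq) nc nc′) e)))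
               (trans (cong (Q ∘ s′) (sym (same z (∧-fst (P z) pq) nc nc′))) (trans (cong Q (ss′ z)) (not-true (∧-snd (P z) pq))))
        ... | inj₁ r = inj₁ (trans (sym (ss z)) (cong s r))
        ... | inj₂ r = inj₂ (trans (sym (ss z)) (cong s r))

      -- When `Q` contains both ends, the part of `Q` in `P` is `P` minus the remainder, and both of
      -- these have at most two crossings.
      half : Span s (λ z → P z ∧ Q z)
      half with true? (Q c) | true? (Q c′)
      ... | inj₁ a | inj₁ b = plus (one P-cut) (one (complement a b)) (λ x → split (P x) (Q x))
        where
        split : ∀ a b → a ∧ b ≡ a xor (a ∧ not b)
        split true true = refl
        split true false = refl
        split false b = refl
      ... | inj₂ a | _ = one (direct λ (b , _) → true≢false b a)
      ... | inj₁ _ | inj₂ a = one (direct λ (_ , b) → true≢false b a)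

  module Lift {s : Fin n → Fin n} (S : FPFInvolution s) {c c′ : Fin n} (c′≢c : c′ ≢ c) (c′≢d : c′ ≢ s c)
    (P : Subset n) (P0 : Invariant P t0) (P2 : Invariant P t2) (P′ : Invariant P (Switch.s′ s S c c′ c′≢c c′≢d))
    (Pc : P ∋ c) (Pc′ : P ∋ c′) (Pd : P (s c) ≡ false) (Pd′ : P (s c′) ≡ false) where
    open Switch s S c c′ c′≢c c′≢d

    ss′ = proj₁ s′-involution

    inside : ∀ z → P ∋ z → z ≢ c → z ≢ c′ → s′ z ≡ s z
    inside z pz nc nc′ = s′-off λ where
      0th → nc refl
      1st → nc′ refl
      2nd → true≢false pz Pd
      3rd → true≢false pz Pd′

    outside : ∀ z → not (P z) ≡ true → z ≢ d → z ≢ d′ → s′ z ≡ s z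
    outside z pz nd nd′ = s′-off λ where
      0th → true≢false Pc (not-true pz)
      1st → true≢false Pc′ (not-true pz)
      2nd → nd refl
      3rd → nd′ refl

    -- The two sides of the cut are treated alike: `s′` joins `c` with `c′` inside `P` and `d` with
    -- `d′` outside, so each part of `Q` is handled by `Half`.
    lift-cut : {Q : Subset n} → SmallCut s′ Q → Span s Q
    lift-cut {Q} q = plus
      (Half.half s s′ ss ss′ P P0 P2 P′ c c′ s′c s′c′ inside q)
      (Half.half s s′ ss ss′ (not ∘ P) (λ z → cong not (P0 z)) (λ z → cong not (P2 z)) (λ z → cong not (P′ z))
        d d′ s′d s′d′ outside q)
      (λ x → split (P x) (Q x))
      where
      split : ∀ a b → b ≡ (a ∧ b) xor (not a ∧ b)
      split true true = refl
      split true false = refl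
      split false b = refl

    lift : {A : Subset n} → Span s′ A → Span s A
    lift (none h) = none h
    lift (add p b h) = plus (lift-cut p) (lift b) h

-- The induction on the number of crossings

module Main {n : ℕ} (t0 t2 : Fin n → Fin n) (E : EdgePair t0 t2)
  (A : Subset n) (A0 : Invariant A t0) (A2 : Invariant A t2) where
  open EdgePair E
  open Spans t0 t2

  K : (Fin n → Fin n) → Part n
  K s = gen (s ∷ t0 ∷ t2 ∷ [])

  #e : ℕ
  #e = count (gen (t0 ∷ t2 ∷ []))

  #k : (Fin n → Fin n) → ℕ
  #k s = count (K s)

  -- Euler genus at most 1 for the flag system with t0 = b, t1 = s, t2 = a.
  Low : (a b s : Fin n → Fin n) → Set
  Low a b s = #e + 2 * #k s ≤ suc (count (gen (a ∷ s ∷ [])) + count (gen (b ∷ s ∷ [])))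

  -- Covers G and G^A by the same argument: `a` plays `t2` and `b` plays `t0`. At each flag they are
  -- the original two in some order, so edges and components are shared while vertices and faces
  -- differ.
  record Resolution (a b : Fin n → Fin n) : Set where
    field
      pair   : EdgePair b a
      either : ∀ z → (a z ≡ t0 z × b z ≡ t2 z) ⊎ (a z ≡ t2 z × b z ≡ t0 z)

    module _ (p : Part n) (ha : ∀ z → p ⊢ z ∼ a z) (hb : ∀ z → p ⊢ z ∼ b z) where
      via0 : ∀ z → p ⊢ z ∼ t0 z
      via0 z with either z
      ... | inj₁ (e , _) = trans (ha z) (cong (cls p) e)
      ... | inj₂ (_ , e) = trans (hb z) (cong (cls p) e)
      via2 : ∀ z → p ⊢ z ∼ t2 z
      via2 z with either z
      ... | inj₁ (_ , e) = trans (hb z) (cong (cls p) e)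
      ... | inj₂ (e , _) = trans (ha z) (cong (cls p) e)

    module _ (p : Part n) (h0 : ∀ z → p ⊢ z ∼ t0 z) (h2 : ∀ z → p ⊢ z ∼ t2 z) where
      viaA : ∀ z → p ⊢ z ∼ a z
      viaA z with either z
      ... | inj₁ (e , _) = trans (h0 z) (cong (cls p) (sym e))
      ... | inj₂ (e , _) = trans (h2 z) (cong (cls p) (sym e))
      viaB : ∀ z → p ⊢ z ∼ b z
      viaB z with either z
      ... | inj₁ (_ , e) = trans (h2 z) (cong (cls p) (sym e))
      ... | inj₂ (_ , e) = trans (h0 z) (cong (cls p) (sym e))

    euler : {s : Fin n → Fin n} → FPFInvolution s →
      count (gen (a ∷ s ∷ [])) + count (gen (b ∷ s ∷ [])) ≤ #e + 2 * #k s
    euler {s} S = ≤-trans (Euler.euler b s a pair S) (+-mono-≤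
      (count-mono (gen-⊑ _ (gen (b ∷ a ∷ [])) (via0 (gen (b ∷ a ∷ [])) (gen-∼ 1st) (gen-∼ 0th) ∷ via2 (gen (b ∷ a ∷ [])) (gen-∼ 1st) (gen-∼ 0th) ∷ [])))
      (*-monoʳ-≤ 2 (count-mono (gen-⊑ _ (gen (s ∷ b ∷ a ∷ []))
        (gen-∼ 0th ∷ via0 (gen (s ∷ b ∷ a ∷ [])) (gen-∼ 2nd) (gen-∼ 1st) ∷ via2 (gen (s ∷ b ∷ a ∷ [])) (gen-∼ 2nd) (gen-∼ 1st) ∷ [])))))

  -- The `t2` and the `t0` of the partial dual along `A`.
  τ τ′ : Fin n → Fin n
  τ = mix A t0 t2
  τ′ = mix A t2 t0

  plain : Resolution t2 t0
  plain = record { pair = E ; either = λ _ → inj₂ (refl , refl) }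

  mixed : Resolution τ τ′
  mixed = record
    { pair = record
      { inv0 = mix-involution A2 A0 inv2 inv0 ; inv2 = mix-involution A0 A2 inv0 inv2
      ; comm = comm′ ; diff = diff′ }
    ; either = λ z → either z }
    where
    either : ∀ z → (τ z ≡ t0 z × τ′ z ≡ t2 z) ⊎ (τ z ≡ t2 z × τ′ z ≡ t0 z)
    either z with true? (A z)
    ... | inj₁ e = inj₁ (mix-true A e , mix-true A e)
    ... | inj₂ e = inj₂ (mix-false A e , mix-false A e)
    comm′ : ∀ z → τ′ (τ z) ≡ τ (τ′ z)
    comm′ z with true? (A z)
    ... | inj₁ e = trans (cong τ′ (mix-true A e)) (trans (mix-true A (trans (A0 z) e))
          (trans (sym (comm z)) (sym (trans (cong τ (mix-true A e)) (mix-true A (trans (A2 z) e))))))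
    ... | inj₂ e = trans (cong τ′ (mix-false A e)) (trans (mix-false A (trans (A2 z) e))
          (trans (comm z) (sym (trans (cong τ (mix-false A e)) (mix-false A (trans (A0 z) e))))))
    diff′ : ∀ z → τ′ z ≢ τ z
    diff′ z e with either z
    ... | inj₁ (p , q) = diff z (sym (trans (sym q) (trans e p)))
    ... | inj₂ (p , q) = diff z (trans (sym q) (trans e p))

  module Step (s : Fin n → Fin n) (S : FPFInvolution s) where
    open Crossings A s S

    -- An arc between crossings never leaves its side of `A`, so only the values of `t` on that side
    -- matter. This turns arcs of G into arcs of G^A.
    transfer : {t t′ : Fin n → Fin n} (b : Bool) → Invariant A t → (∀ z → A z ≡ b → t′ z ≡ t z) →
      ∀ {x y} → A x ≡ b → cut s t X ⊢ x ∼ y → cut s t′ X ⊢ x ∼ y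
    transfer {t} {t′} b At h ax r = proj₂ (gen-elim _ {λ x y → A x ≡ A y × (A x ≡ b → cut s t′ X ⊢ x ∼ y)}
      (record { refl = refl , λ _ → refl
              ; sym = λ (e , f) → sym e , λ e′ → sym (f (trans e e′))
              ; trans = λ (e , f) (e′ , f′) → trans e e′ , λ e″ → trans (f e″) (f′ (trans (sym e) e″)) })
      ((λ z → sym (At z) , λ az → trans (gen-∼ 0th z) (cong (cls (cut s t′ X)) (h z az))) ∷
       (λ z → cut-A At (gen-∼ 1st z) , λ _ → gen-∼ 1st z) ∷ []) r) ax

    record Cut : Set where
      field
        c c′     : Fin n
        Xc       : X ∋ c
        Xc′      : X ∋ c′
        side     : A c′ ≡ A c
        c′≢c     : c′ ≢ c
        c′≢d     : c′ ≢ s c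
        separate : ¬ (K (Switch.s′ s S c c′ c′≢c c′≢d) ⊢ c ∼ s c)

    module Reconnect {c c′ : Fin n} (Xc : X ∋ c) (Xc′ : X ∋ c′) (side : A c′ ≡ A c) (c′≢c : c′ ≢ c) where
      c′≢d : c′ ≢ s c
      c′≢d e = not-¬ (sym (trans (sym side) (cong A e))) (xor-true (A c) (A (s c)) Xc)

      module SW = Switch s S c c′ c′≢c c′≢d

      ends⊆X : ∀ z → SW.X ∋ z → X ∋ z
      ends⊆X z e = go (SW.X⇒∈ e)
        where
        go : ∀ {z} → z ∈ SW.ends → X ∋ z
        go 0th = Xc
        go 1st = Xc′
        go 2nd = Xs c Xc
        go 3rd = Xs c′ Xc′

      -- An arc on either side of the crossings will do, since `dd′⇒cc′` carries it over. The
      -- agreeing arcs may thus lie on opposite sides.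
      Parallel : (Fin n → Fin n) → Set
      Parallel t = cut s t X ⊢ c ∼ c′ ⊎ cut s t X ⊢ s c ∼ s c′

      grow : {t : Fin n → Fin n} → FPFInvolution t → Parallel t →
        suc (count (gen (t ∷ s ∷ []))) ≤ count (gen (t ∷ SW.s′ ∷ []))
      grow {t} T (inj₁ r) = SW.Curves.splits t T (off-⊑ ends⊆X r)
      grow {t} T (inj₂ r) = SW.Curves.splits t T (SW.Curves.dd′⇒cc′ t T (off-⊑ ends⊆X r))

      -- Reconnecting gains a vertex and a face, which at Euler genus at most 1 forces a new component.
      make-cut : {a b : Fin n → Fin n} → Resolution a b → Low a b s → Parallel a → Parallel b → Cut
      make-cut {a} {b} res low pa pb = record
        { c = c ; c′ = c′ ; Xc = Xc ; Xc′ = Xc′ ; side = side ; c′≢c = c′≢c ; c′≢d = c′≢d ; separate = separate }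
        where
        open Resolution res
        open ≤-Reasoning
        separate : ¬ (K SW.s′ ⊢ c ∼ s c)
        separate r = <-irrefl refl (begin
          suc (suc (#v + #f))               ≡⟨ cong suc (+-suc #v #f) ⟨
          suc #v + suc #f                   ≤⟨ +-mono-≤ (grow (EdgePair.inv2 pair) pa) (grow (EdgePair.inv0 pair) pb) ⟩
          _                                 ≤⟨ euler SW.s′-involution ⟩
          #e + 2 * #k SW.s′                 ≤⟨ +-monoʳ-≤ #e (*-monoʳ-≤ 2 (count-mono (gen-⊑ _ p
                                                 (SW.s-⊑ p (λ z x → trans (gen-∼ 0th z) (cong (cls p) (SW.s′-off (SW.X̸⇒∉ x)))) r r′ ∷ gen-∼ 1st ∷ gen-∼ 2nd ∷ [])))) ⟩
          #e + 2 * #k s                     ≤⟨ low ⟩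
          suc (#v + #f)                     ∎)
          where
          p : Part n
          p = K SW.s′
          #v #f : ℕ
          #v = count (gen (a ∷ s ∷ []))
          #f = count (gen (b ∷ s ∷ []))
          r′ : p ⊢ c′ ∼ s c′
          r′ = trans (gen-∼ 0th c′) (trans (cong (cls p) SW.s′c′) (trans r (trans (gen-∼ 0th (s c)) (cong (cls p) SW.s′d))))

    open Agreement t0 t2 E A0 A2 using (module C0; module C2; agreement)

    -- If the vertex and face pairings of G agree on one side, the reconnection is compared with the
    -- genus of G. If two vertex pairings agree across the sides, then in G^A the arc inside `A`
    -- lies on a face and the one outside on a vertex, so the genus of G^A is used; for two face
    -- pairings the roles are exchanged.
    find-cut : Low t2 t0 s → Low τ τ′ s → (∃ λ z → X ∋ z) → Cut
    find-cut low low′ x with agreement x low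
    ... | z , xz , inj₁ e = Reconnect.make-cut xz (C2.ρ-in xz) (C2.ρ-A xz) (C2.ρ-≢ xz) plain low
          (inj₁ (C2.ρ-∼ xz)) (inj₁ (trans (C0.ρ-∼ xz) (cong (cls (cut s t0 X)) (sym e))))
    ... | z , xz , inj₂ (inj₁ e) with true? (A z)
    ...   | inj₁ a = Reconnect.make-cut xz (C2.ρ-in xz) (C2.ρ-A xz) (C2.ρ-≢ xz) mixed low′
          (inj₂ (transfer false A2 (λ _ → mix-false A) (trans (xor-true (A z) (A (s z)) xz) (cong not a))
            (trans (C2.ρ-∼ (Xs z xz)) (cong (cls (cut s t2 X)) (trans (sym (ss _)) (cong s (sym e)))))))
          (inj₁ (transfer true A2 (λ _ → mix-true A) a (C2.ρ-∼ xz)))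
    ...   | inj₂ a = Reconnect.make-cut xz (C2.ρ-in xz) (C2.ρ-A xz) (C2.ρ-≢ xz) mixed low′
          (inj₁ (transfer false A2 (λ _ → mix-false A) a (C2.ρ-∼ xz)))
          (inj₂ (transfer true A2 (λ _ → mix-true A) (trans (xor-true (A z) (A (s z)) xz) (cong not a))
            (trans (C2.ρ-∼ (Xs z xz)) (cong (cls (cut s t2 X)) (trans (sym (ss _)) (cong s (sym e)))))))
    find-cut low low′ x | z , xz , inj₂ (inj₂ e) with true? (A z)
    ...   | inj₁ a = Reconnect.make-cut xz (C0.ρ-in xz) (C0.ρ-A xz) (C0.ρ-≢ xz) mixed low′
          (inj₁ (transfer true A0 (λ _ → mix-true A) a (C0.ρ-∼ xz)))
          (inj₂ (transfer false A0 (λ _ → mix-false A) (trans (xor-true (A z) (A (s z)) xz) (cong not a))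
            (trans (C0.ρ-∼ (Xs z xz)) (cong (cls (cut s t0 X)) (trans (sym (ss _)) (cong s (sym e)))))))
    ...   | inj₂ a = Reconnect.make-cut xz (C0.ρ-in xz) (C0.ρ-A xz) (C0.ρ-≢ xz) mixed low′
          (inj₂ (transfer true A0 (λ _ → mix-true A) (trans (xor-true (A z) (A (s z)) xz) (cong not a))
            (trans (C0.ρ-∼ (Xs z xz)) (cong (cls (cut s t0 X)) (trans (sym (ss _)) (cong s (sym e)))))))
          (inj₁ (transfer false A0 (λ _ → mix-false A) a (C0.ρ-∼ xz)))

    module AlongCut (cut₀ : Cut) where
      open Cut cut₀
      open Switch s S c c′ c′≢c c′≢d public using (s′; s′-involution)
      module W = Switch s S c c′ c′≢c c′≢d

      K′ : Part n
      K′ = K s′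

      -- The component of `c` after reconnecting. As a component it is invariant under `t0`, `t2`
      -- and `s′`, and for `s` it is one side of the cut.
      P : Subset n
      P z = cls K′ z == cls K′ c

      P-resp : ∀ {x y} → K′ ⊢ x ∼ y → P y ≡ P x
      P-resp e = cong (_== cls K′ c) (sym e)

      Pc : P ∋ c
      Pc = ≡⇒== {x = cls K′ c} refl
      Pd : P (s c) ≡ false
      Pd = ≢⇒== (λ e → separate (sym e))

      lift : Span s′ A → Span s A
      lift = Lift.lift S c′≢c c′≢d P (λ z → P-resp (gen-∼ 1st z)) (λ z → P-resp (gen-∼ 2nd z)) (λ z → P-resp (gen-∼ 0th z))
        Pc (trans (P-resp (trans (gen-∼ 0th c) (cong (cls K′) W.s′c))) Pc)
        Pd (trans (P-resp (trans (gen-∼ 0th (s c)) (cong (cls K′) W.s′d))) Pd)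

      -- One merge undoes the reconnection: `s′` keeps `c` with `c′` and `s c` with `s c′`, so
      -- joining `c` to `s c` also joins `c′` to `s c′`.
      #k′≤ : #k s′ ≤ suc (#k s)
      #k′≤ = ≤-trans (merge-count-≤ K′ c (s c)) (s≤s (count-mono (gen-⊑ _ p
          (W.s-⊑ p (λ z x → up (trans (gen-∼ 0th z) (cong (cls K′) (W.s′-off (W.X̸⇒∉ x))))) cd c′d′
           ∷ (λ z → up (gen-∼ 1st z)) ∷ (λ z → up (gen-∼ 2nd z)) ∷ []))))
        where
        p = merge K′ c (s c)
        up : K′ ⊑ p
        up = merge-⊒ K′ c (s c)
        cd : p ⊢ c ∼ s c
        cd = merge-∼ K′ c (s c)
        c′d′ : p ⊢ c′ ∼ s c′
        c′d′ = trans (up (trans (gen-∼ 0th c′) (cong (cls K′) W.s′c′)))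
                 (trans cd (up (trans (gen-∼ 0th (s c)) (cong (cls K′) W.s′d))))

      -- Vertices and faces each increase by at least one, because separation forces the arc from
      -- `c` to end at `c′`. Components increase by at most one and count twice, so the bound
      -- survives. The same cut serves G and G^A, whichever of them produced it.
      low-after : {a b : Fin n → Fin n} → Resolution a b → Low a b s → Low a b s′
      low-after {a} {b} res low = begin
        #e + 2 * #k s′                 ≤⟨ +-monoʳ-≤ #e (*-monoʳ-≤ 2 #k′≤) ⟩
        #e + 2 * suc (#k s)            ≡⟨ solve 2 (λ e k → e :+ con 2 :* (con 1 :+ k) := con 2 :+ (e :+ con 2 :* k)) refl #e (#k s) ⟩
        2 + (#e + 2 * #k s)            ≤⟨ s≤s (s≤s low) ⟩
        3 + (#v + #f)                  ≡⟨ solve 2 (λ v f → con 3 :+ (v :+ f) := con 1 :+ ((con 1 :+ v) :+ (con 1 :+ f))) refl #v #f ⟩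
        suc (suc #v + suc #f)          ≤⟨ s≤s (+-mono-≤ (gain (EdgePair.inv2 pair) (viaA K′ (gen-∼ 1st) (gen-∼ 2nd)))
                                                        (gain (EdgePair.inv0 pair) (viaB K′ (gen-∼ 1st) (gen-∼ 2nd)))) ⟩
        _                              ∎
        where
        open Resolution res
        open ≤-Reasoning
        open +-*-Solver
        #v = count (gen (a ∷ s ∷ []))
        #f = count (gen (b ∷ s ∷ []))
        gain : {t : Fin n → Fin n} → FPFInvolution t → (∀ z → K′ ⊢ z ∼ t z) →
          suc (count (gen (t ∷ s ∷ []))) ≤ count (gen (t ∷ s′ ∷ []))
        gain {t} T h = W.Curves.splits t T (W.Curves.separated t T K′ h (gen-∼ 0th) separate)

      -- `c` ceases to be a crossing, as `s′` sends it to `c′` on the same side, and only flags that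
      -- were crossings are reconnected.
      fewer : suc (card (Crossings.X A s′ s′-involution)) ≤ card X
      fewer = card-strict c sub (same-side (trans (cong A W.s′c) side)) Xc
        where
        same-side : ∀ {a b : Bool} → b ≡ a → a xor b ≡ false
        same-side {true} refl = refl
        same-side {false} refl = refl
        sub : ∀ z → A z xor A (s′ z) ≡ true → X ∋ z
        sub z e with true? (W.X z)
        ... | inj₂ x = trans (cong (λ y → A z xor A y) (sym (W.s′-off (W.X̸⇒∉ x)))) e
        ... | inj₁ x = go (W.X⇒∈ x) e
          where
          go : ∀ {z} → z ∈ W.ends → A z xor A (s′ z) ≡ true → X ∋ z
          go 0th _ = Xc
          go 1st _ = Xc′
          go 2nd _ = Xs c Xc
          go 3rd _ = Xs c′ Xc′

  main : Fin n → ∀ k (s : Fin n → Fin n) (S : FPFInvolution s) → Low t2 t0 s → Low τ τ′ s →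
    card (Crossings.X A s S) ≤ k → Span s A
  main o k s S low low′ l with decide (Crossings.X A s S)
  -- Without crossings `A` is itself a small cut; the given flag `o` merely fills the places of `u`
  -- and `w`.
  ... | inj₂ h = one (record { inv0 = A0 ; inv2 = A2 ; u = o ; w = o
      ; only = λ z a b → ⊥-elim (true≢false (xor-intro {A z} (trans b (cong not (sym a)))) (h z)) })
  ... | inj₁ x = go k l
    where
    open Step s S
    open AlongCut (find-cut low low′ x)
    go : ∀ k → card (Crossings.X A s S) ≤ k → Span s A
    go zero l = ⊥-elim (n≮0 (≤-trans fewer l))
    go (suc k) l = lift (main o k s′ s′-involution (low-after plain low) (low-after mixed low′) (≤-pred (≤-trans fewer l)))

-- Orbit counts

Star-equiv : {T : Fin n → Fin n → Set} → (∀ {x y} → T x y → T y x) → IsEquivalence (Star T)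
Star-equiv h = record { refl = ε ; sym = reverse h ; trans = _◅◅_ }

Star-∼ : (p : Part n) {T : Fin n → Fin n → Set} → (∀ {x y} → T x y → p ⊢ x ∼ y) → ∀ {x y} → Star T x y → p ⊢ x ∼ y
Star-∼ p h ε = refl
Star-∼ p h (r ◅ rs) = trans (h r) (Star-∼ p h rs)

card-all : (k : ℕ) → card {k} (const true) ≡ k
card-all zero = refl
card-all (suc k) = cong suc (card-all k)

orbit-count : {R : Fin n → Fin n → Set} {k : ℕ} (p : Part n) →
  (∀ {x y} → p ⊢ x ∼ y → R x y) → (∀ {x y} → R x y → p ⊢ x ∼ y) → OrbitCount R k → k ≡ count p
orbit-count {k = k} p to from (f , onto , eq) = trans (≤-antisym
  (≤-trans (≤-reflexive (sym (card-all k))) (card-inj {P = const true} (λ j → cls p (proj₁ (onto j))) (λ j _ → fix-cls p _)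
    (λ i j _ _ e → trans (sym (proj₂ (onto i))) (trans (proj₂ (eq _ _)
      (to (trans (sym (idem p _)) (trans (cong (cls p) e) (idem p _))))) (proj₂ (onto j))))))
  (≤-trans (card-inj {Q = const true} f (λ _ _ → refl)
    (λ x y fx fy e → trans (sym (==⇒≡ fx)) (trans (from (proj₁ (eq x y) e)) (==⇒≡ fy)))) (≤-reflexive (card-all k))))
  (sym (count-def p))

flip-involution : {f : Fin n → Fin n} → FPFInvolution f → ∀ {x y} → y ≡ f x → x ≡ f y
flip-involution F {x} refl = sym (proj₁ F x)

module Orbits (G : RG) (G-rg : IsRG G) where
  T0 = proj₁ G-rg
  T1 = proj₁ (proj₂ G-rg)
  T2 = proj₁ (proj₂ (proj₂ G-rg))

  edgePair : EdgePair (t0 G) (t2 G)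
  edgePair = record { inv0 = T0 ; inv2 = T2
    ; comm = proj₁ (proj₂ (proj₂ (proj₂ G-rg))) ; diff = proj₂ (proj₂ (proj₂ (proj₂ G-rg))) }

  two : {f g : Fin (RG.n G) → Fin (RG.n G)} → FPFInvolution f → FPFInvolution g → {k : ℕ} →
    OrbitCount (Star (λ x y → y ≡ f x ⊎ y ≡ g x)) k → k ≡ count (gen (f ∷ g ∷ []))
  two {f} {g} F G′ = orbit-count (gen (f ∷ g ∷ []))
    (gen-elim _ (Star-equiv (λ { (inj₁ e) → inj₁ (flip-involution F e) ; (inj₂ e) → inj₂ (flip-involution G′ e) }))
      ((λ x → inj₁ refl ◅ ε) ∷ (λ x → inj₂ refl ◅ ε) ∷ []))
    (Star-∼ (gen (f ∷ g ∷ [])) λ { (inj₁ refl) → gen-∼ 0th _ ; (inj₂ refl) → gen-∼ 1st _ })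

  components : {k : ℕ} → OrbitCount (SameComponent G) k → k ≡ count (gen (t1 G ∷ t0 G ∷ t2 G ∷ []))
  components = orbit-count (gen (t1 G ∷ t0 G ∷ t2 G ∷ []))
    (gen-elim _ (Star-equiv λ { (inj₁ e) → inj₁ (flip-involution T0 e)
                              ; (inj₂ (inj₁ e)) → inj₂ (inj₁ (flip-involution T1 e))
                              ; (inj₂ (inj₂ e)) → inj₂ (inj₂ (flip-involution T2 e)) })
      ((λ x → inj₂ (inj₁ refl) ◅ ε) ∷ (λ x → inj₁ refl ◅ ε) ∷ (λ x → inj₂ (inj₂ refl) ◅ ε) ∷ []))
    (Star-∼ (gen (t1 G ∷ t0 G ∷ t2 G ∷ [])) λ { (inj₁ refl) → gen-∼ 1st _ ; (inj₂ (inj₁ refl)) → gen-∼ 0th _ ; (inj₂ (inj₂ refl)) → gen-∼ 2nd _ })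

  -- An isolated vertex is a vertex, a face and a component at once, so it adds 2 to both sides of
  -- Euler's formula and cancels.
  low : {g : ℕ} → g ≤ 1 → EulerGenus G g →
    count (gen (t0 G ∷ t2 G ∷ [])) + 2 * count (gen (t1 G ∷ t0 G ∷ t2 G ∷ []))
      ≤ suc (count (gen (t2 G ∷ t1 G ∷ [])) + count (gen (t0 G ∷ t1 G ∷ [])))
  low {g} g≤1 (_ , _ , e , _ , (k , ok , refl) , (v , ov , refl) , oe , (f , of , refl) , eq)
    rewrite components ok | two T0 T2 oe = +-cancelʳ-≤ (iso G + iso G) _ _ (begin
      #e + 2 * #k + (iso G + iso G)                     ≡⟨ solve 3 (λ e k i → e :+ con 2 :* k :+ (i :+ i) := e :+ con 2 :* (k :+ i)) refl #e #k (iso G) ⟩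
      #e + 2 * (#k + iso G)                             ≡⟨ eq ⟨
      v + iso G + (f + iso G) + g                       ≤⟨ +-monoʳ-≤ _ g≤1 ⟩
      v + iso G + (f + iso G) + 1                       ≡⟨ solve 3 (λ v f i → v :+ i :+ (f :+ i) :+ con 1 := con 1 :+ (v :+ f) :+ (i :+ i)) refl v f (iso G) ⟩
      suc (v + f) + (iso G + iso G)                     ≡⟨ cong (λ w → suc w + (iso G + iso G)) (cong₂ _+_ v≡ (two T0 T1 of)) ⟩
      suc (count (gen (t2 G ∷ t1 G ∷ [])) + count (gen (t0 G ∷ t1 G ∷ []))) + (iso G + iso G) ∎)
    where
    open ≤-Reasoning
    open +-*-Solver
    #e = count (gen (t0 G ∷ t2 G ∷ []))
    #k = count (gen (t1 G ∷ t0 G ∷ t2 G ∷ []))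
    v≡ : v ≡ count (gen (t2 G ∷ t1 G ∷ []))
    v≡ = trans (two T1 T2 ov) (≤-antisym (count-mono (gen-⊑ _ (gen (t1 G ∷ t2 G ∷ [])) (gen-∼ 1st ∷ gen-∼ 0th ∷ [])))
                                         (count-mono (gen-⊑ _ (gen (t2 G ∷ t1 G ∷ [])) (gen-∼ 1st ∷ gen-∼ 0th ∷ []))))

-- Isomorphisms and partial duals

≅-sym : {G H : RG} → G ≅ H → H ≅ G
≅-sym {G} {H} φ = record
  { to = from ; from = to ; from∘to = to∘from ; to∘from = from∘to
  ; com0 = back com0 ; com1 = back com1 ; com2 = back com2 ; isoEq = sym isoEq }
  where
  open _≅_ φ
  back : {f : Fin (RG.n G) → Fin (RG.n G)} {g : Fin (RG.n H) → Fin (RG.n H)} →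
    (∀ x → to (f x) ≡ g (to x)) → ∀ y → from (g y) ≡ f (from y)
  back {f} {g} h y = trans (cong (from ∘ g) (sym (to∘from y))) (trans (cong from (sym (h (from y)))) (from∘to _))

≅-trans : {G H J : RG} → G ≅ H → H ≅ J → G ≅ J
≅-trans φ ψ = record
  { to = Ψ.to ∘ Φ.to ; from = Φ.from ∘ Ψ.from
  ; from∘to = λ x → trans (cong Φ.from (Ψ.from∘to _)) (Φ.from∘to x)
  ; to∘from = λ y → trans (cong Ψ.to (Φ.to∘from _)) (Ψ.to∘from y)
  ; com0 = λ x → trans (cong Ψ.to (Φ.com0 x)) (Ψ.com0 _)
  ; com1 = λ x → trans (cong Ψ.to (Φ.com1 x)) (Ψ.com1 _)
  ; com2 = λ x → trans (cong Ψ.to (Φ.com2 x)) (Ψ.com2 _)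
  ; isoEq = trans Φ.isoEq Ψ.isoEq }
  where
  module Φ = _≅_ φ
  module Ψ = _≅_ ψ

OrbitCount-≅ : {G H : RG} (φ : G ≅ H) {T : Fin (RG.n G) → Fin (RG.n G) → Set} {U : Fin (RG.n H) → Fin (RG.n H) → Set} →
  (∀ {x y} → T x y → U (_≅_.to φ x) (_≅_.to φ y)) → (∀ {x y} → U x y → T (_≅_.from φ x) (_≅_.from φ y)) →
  {k : ℕ} → OrbitCount (Star U) k → OrbitCount (Star T) k
OrbitCount-≅ φ {T} TU UT (f , onto , eq) = f ∘ to
  , (λ j → let x , e = onto j in from x , trans (cong f (to∘from x)) e)
  , (λ x y → (λ e → subst₂ (Star T) (from∘to x) (from∘to y) (gmap from UT (proj₁ (eq _ _) e)))
           , (λ r → proj₂ (eq _ _) (gmap to TU r)))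
  where open _≅_ φ

EulerGenus-≅ : {G H : RG} → G ≅ H → {g : ℕ} → EulerGenus H g → EulerGenus G g
EulerGenus-≅ {G} {H} φ (k , v , e , f , (k′ , ok , ek) , (v′ , ov , ev) , oe , (f′ , of , ef) , eq) =
  k , v , e , f
  , (k′ , OrbitCount-≅ φ
      (λ { (inj₁ refl) → inj₁ (com0 _) ; (inj₂ (inj₁ refl)) → inj₂ (inj₁ (com1 _)) ; (inj₂ (inj₂ refl)) → inj₂ (inj₂ (com2 _)) })
      (λ { (inj₁ refl) → inj₁ (B.com0 _) ; (inj₂ (inj₁ refl)) → inj₂ (inj₁ (B.com1 _)) ; (inj₂ (inj₂ refl)) → inj₂ (inj₂ (B.com2 _)) }) ok
    , trans ek (cong (k′ +_) (sym isoEq)))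
  , (v′ , OrbitCount-≅ φ (λ { (inj₁ refl) → inj₁ (com1 _) ; (inj₂ refl) → inj₂ (com2 _) })
                         (λ { (inj₁ refl) → inj₁ (B.com1 _) ; (inj₂ refl) → inj₂ (B.com2 _) }) ov
    , trans ev (cong (v′ +_) (sym isoEq)))
  , OrbitCount-≅ φ (λ { (inj₁ refl) → inj₁ (com0 _) ; (inj₂ refl) → inj₂ (com2 _) })
                   (λ { (inj₁ refl) → inj₁ (B.com0 _) ; (inj₂ refl) → inj₂ (B.com2 _) }) oe
  , (f′ , OrbitCount-≅ φ (λ { (inj₁ refl) → inj₁ (com0 _) ; (inj₂ refl) → inj₂ (com1 _) })
                         (λ { (inj₁ refl) → inj₁ (B.com0 _) ; (inj₂ refl) → inj₂ (B.com1 _) }) of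
    , trans ef (cong (f′ +_) (sym isoEq)))
  , eq
  where
  open _≅_ φ
  module B = _≅_ (≅-sym φ)

partialDual-cong : (G : RG) {A B : Subset (RG.n G)} → (∀ x → A x ≡ B x) → partialDual G A ≅ partialDual G B
partialDual-cong G h = record
  { to = id ; from = id ; from∘to = λ _ → refl ; to∘from = λ _ → refl
  ; com0 = λ x → cong (λ b → if b then t2 G x else t0 G x) (h x)
  ; com1 = λ _ → refl
  ; com2 = λ x → cong (λ b → if b then t0 G x else t2 G x) (h x)
  ; isoEq = refl }

partialDual-twice : (G : RG) {A B C : Subset (RG.n G)} → (∀ x → C x ≡ A x xor B x) →
  partialDual (partialDual G A) B ≅ partialDual G C
partialDual-twice G {A} {B} {C} h = record
  { to = id ; from = id ; from∘to = λ _ → refl ; to∘from = λ _ → refl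
  ; com0 = λ x → trans (pick (A x) (B x)) (cong (λ b → if b then t2 G x else t0 G x) (sym (h x)))
  ; com1 = λ _ → refl
  ; com2 = λ x → trans (pick (A x) (B x)) (cong (λ b → if b then t0 G x else t2 G x) (sym (h x)))
  ; isoEq = refl }
  where
  pick : {y z : Fin (RG.n G)} (a b : Bool) →
    (if b then (if a then y else z) else (if a then z else y)) ≡ (if a xor b then z else y)
  pick true true = refl
  pick true false = refl
  pick false true = refl
  pick false false = refl

partialDual-≅ : {G H : RG} (φ : G ≅ H) (B : Subset (RG.n H)) → partialDual G (B ∘ _≅_.to φ) ≅ partialDual H B
partialDual-≅ {G} {H} φ B = record
  { to = to ; from = from ; from∘to = from∘to ; to∘from = to∘from
  ; com0 = λ x → move (com2 x) (com0 x) ; com1 = com1 ; com2 = λ x → move (com0 x) (com2 x) ; isoEq = isoEq }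
  where
  open _≅_ φ
  move : {b : Bool} {y z : Fin (RG.n G)} {y′ z′ : Fin (RG.n H)} → to y ≡ y′ → to z ≡ z′ →
    to (if b then y else z) ≡ (if b then y′ else z′)
  move {true} e _ = e
  move {false} _ e = e

-- At each flag the dual has the same two edge involutions, perhaps exchanged, so G and its partial
-- dual have the same edge sets.
edgeSet-≅ : {G H : RG} {A : Subset (RG.n G)} (φ : partialDual G A ≅ H) {B : Subset (RG.n H)} →
  IsEdgeSet H B → IsEdgeSet G (B ∘ _≅_.to φ)
edgeSet-≅ {G} {H} {A} φ {B} (B0 , B2) = inv0 , inv2
  where
  open _≅_ φ
  inv0 : ∀ x → B (to (t0 G x)) ≡ B (to x)
  inv0 x with A x | com0 x | com2 x
  ... | true | _ | e = trans (cong B e) (B2 _)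
  ... | false | e | _ = trans (cong B e) (B0 _)
  inv2 : ∀ x → B (to (t2 G x)) ≡ B (to x)
  inv2 x with A x | com0 x | com2 x
  ... | true | e | _ = trans (cong B e) (B0 _)
  ... | false | _ | e = trans (cong B e) (B2 _)

PartialDuals-step : {G H J : RG} → PartialDuals G H → PartialDuals H J → PartialDuals G J
PartialDuals-step {G} {H} (A , (A0 , A2) , φ) (B , eB , ψ) with edgeSet-≅ {G} {H} {A} φ eB
... | C0 , C2 = (λ x → A x xor B (to x))
  , ((λ x → cong₂ _xor_ (A0 x) (C0 x)) , (λ x → cong₂ _xor_ (A2 x) (C2 x)))
  , ≅-trans (≅-sym (partialDual-twice G {A} {B ∘ to} (λ _ → refl))) (≅-trans (partialDual-≅ φ B) ψ)
  where open _≅_ φ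

PartialDuals-refl : {G : RG} → PartialDuals G G
PartialDuals-refl {G} = const false , ((λ _ → refl) , (λ _ → refl)) , partialDual-cong G {const false} {const false} (λ _ → refl)

moves⇒partialDuals : {G H : RG} → Star Move G H → PartialDuals G H
moves⇒partialDuals ε = PartialDuals-refl
moves⇒partialDuals {G} ((A , join , φ) ◅ ms) = PartialDuals-step
  (not ∘ A , ((λ x → cong not (proj₁ edgeSet x)) , (λ x → cong not (proj₂ edgeSet x))) , φ)
  (moves⇒partialDuals ms)
  where open IsJoin join

related⇒partialDuals : {G H : RG} → RelatedByDuallingJoinSummands G H → PartialDuals G H
related⇒partialDuals (inj₁ (K , ms , φ)) =
  PartialDuals-step (moves⇒partialDuals ms) (const false , ((λ _ → refl) , (λ _ → refl)) , φ)
related⇒partialDuals (inj₂ φ) = const true , ((λ _ → refl) , (λ _ → refl)) , φ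

module PartialDual (G : RG) (G-rg : IsRG G) (A : Subset (RG.n G)) (A-edges : IsEdgeSet G A) where
  open Orbits G G-rg using (T1; edgePair)
  open Main (t0 G) (t2 G) edgePair A (proj₁ A-edges) (proj₂ A-edges) using (τ; τ′; mixed; Low; module Resolution)
  open EdgePair (Resolution.pair mixed)

  t0≡ : ∀ z → t0 (partialDual G A) z ≡ τ′ z
  t0≡ z with true? (A z)
  ... | inj₁ e = trans (if-true e) (sym (mix-true A e))
  ... | inj₂ e = trans (if-false e) (sym (mix-false A e))

  t2≡ : ∀ z → t2 (partialDual G A) z ≡ τ z
  t2≡ z with true? (A z)
  ... | inj₁ e = trans (if-true e) (sym (mix-true A e))
  ... | inj₂ e = trans (if-false e) (sym (mix-false A e))

  involution-≗ : {f g : Fin (RG.n G) → Fin (RG.n G)} → (∀ z → f z ≡ g z) → FPFInvolution g → FPFInvolution f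
  involution-≗ {f} {g} h (gg , ne) = (λ z → trans (h _) (trans (cong g (h z)) (gg z))) , λ z e → ne z (trans (sym (h z)) e)

  partialDual-rg : IsRG (partialDual G A)
  partialDual-rg = involution-≗ t0≡ inv0 , T1 , involution-≗ t2≡ inv2
    , (λ x → trans (t0≡ _) (trans (cong τ′ (t2≡ x)) (trans (comm x) (sym (trans (t2≡ _) (cong τ (t0≡ x)))))))
    , (λ x e → diff x (trans (sym (t0≡ x)) (trans e (t2≡ x))))

  low′ : {g : ℕ} → g ≤ 1 → EulerGenus (partialDual G A) g → Low τ τ′ (t1 G)
  low′ g≤1 eg = ≤-trans (+-mono-≤
      (count-mono (gen-⊑ _ q (at q t0≡ (viaB q (gen-∼ 0th) (gen-∼ 1st)) ∷ at q t2≡ (viaA q (gen-∼ 0th) (gen-∼ 1st)) ∷ [])))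
      (*-monoʳ-≤ 2 (count-mono (gen-⊑ _ r (gen-∼ 0th ∷ at r t0≡ (viaB r (gen-∼ 1st) (gen-∼ 2nd)) ∷ at r t2≡ (viaA r (gen-∼ 1st) (gen-∼ 2nd)) ∷ [])))))
    (≤-trans (Orbits.low (partialDual G A) partialDual-rg g≤1 eg)
      (s≤s (+-mono-≤ (count-mono (gen-⊑ _ (gen (u2 ∷ t1 G ∷ [])) (at (gen (u2 ∷ t1 G ∷ [])) (sym ∘ t2≡) (gen-∼ 0th) ∷ gen-∼ 1st ∷ [])))
                     (count-mono (gen-⊑ _ (gen (u0 ∷ t1 G ∷ [])) (at (gen (u0 ∷ t1 G ∷ [])) (sym ∘ t0≡) (gen-∼ 0th) ∷ gen-∼ 1st ∷ []))))))
    where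
    open Resolution mixed
    u0 = t0 (partialDual G A)
    u2 = t2 (partialDual G A)
    q r : Part (RG.n G)
    q = gen (t0 G ∷ t2 G ∷ [])
    r = gen (t1 G ∷ t0 G ∷ t2 G ∷ [])
    at : (p : Part (RG.n G)) {f g : Fin (RG.n G) → Fin (RG.n G)} → (∀ z → f z ≡ g z) → (∀ z → p ⊢ z ∼ g z) → ∀ z → p ⊢ z ∼ f z
    at p h k z = trans (k z) (cong (cls p) (sym (h z)))

  connected : (∀ x y → SameComponent G x y) → ∀ x y → SameComponent (partialDual G A) x y
  connected conn x y = go (conn x y)
    where
    step : ∀ {x y} → y ≡ t0 G x ⊎ y ≡ t1 G x ⊎ y ≡ t2 G x →
      y ≡ t0 (partialDual G A) x ⊎ y ≡ t1 G x ⊎ y ≡ t2 (partialDual G A) x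
    step {x} (inj₁ e) with A x
    ... | true = inj₂ (inj₂ e)
    ... | false = inj₁ e
    step (inj₂ (inj₁ e)) = inj₂ (inj₁ e)
    step {x} (inj₂ (inj₂ e)) with A x
    ... | true = inj₁ e
    ... | false = inj₂ (inj₂ e)
    go : ∀ {x y} → SameComponent G x y → SameComponent (partialDual G A) x y
    go = gmap id step

-- Joins

module Joins {n : ℕ} (t0 t2 s : Fin n → Fin n) (T2 : FPFInvolution t2) (S : FPFInvolution s) where
  open Spans t0 t2

  record TwoCut (P : Subset n) : Set where
    field
      inv0  : Invariant P t0
      inv2  : Invariant P t2
      c₁ c₂ : Fin n
      c₁≢c₂ : c₁ ≢ c₂
      in₁   : P ∋ c₁
      out₁  : P (s c₁) ≡ false
      in₂   : P ∋ c₂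
      out₂  : P (s c₂) ≡ false
      only  : ∀ z → P ∋ z → P (s z) ≡ false → z ≡ c₁ ⊎ z ≡ c₂

  ss = proj₁ S

  crossing⇒X : (P : Subset n) {z : Fin n} → P ∋ z → P (s z) ≡ false → Crossings.X P s S ∋ z
  crossing⇒X P {z} a b = xor-intro {P z} (trans b (cong not (sym a)))

  TwoCut-not : {P : Subset n} → TwoCut P → TwoCut (not ∘ P)
  TwoCut-not {P} p = record
    { inv0 = λ z → cong not (inv0 z) ; inv2 = λ z → cong not (inv2 z)
    ; c₁ = s c₁ ; c₂ = s c₂
    ; c₁≢c₂ = λ e → c₁≢c₂ (trans (sym (ss c₁)) (trans (cong s e) (ss c₂)))
    ; in₁ = cong not out₁ ; out₁ = cong not (trans (cong P (ss c₁)) in₁)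
    ; in₂ = cong not out₂ ; out₂ = cong not (trans (cong P (ss c₂)) in₂)
    ; only = λ z a b → swap z (only (s z) (trans (sym (not-involutive _)) (cong not b)) (trans (cong P (ss z)) (not-true a))) }
    where
    open TwoCut p
    swap : ∀ z → s z ≡ c₁ ⊎ s z ≡ c₂ → z ≡ s c₁ ⊎ z ≡ s c₂
    swap z (inj₁ e) = inj₁ (trans (sym (ss z)) (cong s e))
    swap z (inj₂ e) = inj₂ (trans (sym (ss z)) (cong s e))

  -- The vertex curve leaving through one crossing has to come back through another.
  next-crossing : (P : Subset n) → Invariant P t2 → ∀ {a} → P ∋ a → P (s a) ≡ false →
    ∃ λ b → b ≢ a × P ∋ b × P (s b) ≡ false × cut s t2 (Crossings.X P s S) ⊢ a ∼ b
  next-crossing P P2 {a} pa pa′ = ρ a , ρ-≢ xa , pb , trans (xor-true (P (ρ a)) _ (ρ-in xa)) (cong not pb) , ρ-∼ xa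
    where
    open Crossings.Curve P s S t2 T2 P2
    xa = crossing⇒X P pa pa′
    pb : P ∋ ρ a
    pb = trans (ρ-A xa) pa

  -- A single crossing is impossible, since `next-crossing` supplies a second one. At most two
  -- therefore means none or exactly two.
  small⇒two : {P : Subset n} → SmallCut s P → TwoCut P ⊎ (∀ z → P (s z) ≡ P z)
  small⇒two {P} p with decide (λ z → P z ∧ not (P (s z)))
    where open SmallCut p
  ... | inj₂ closed = inj₂ λ z → ⇔⇒≡ _ _
          (λ a → subst (P ∋_) (ss z) (stay a)) stay
    where
    stay : ∀ {z} → P ∋ z → P ∋ s z
    stay {z} a with true? (P (s z))
    ... | inj₁ b = b
    ... | inj₂ b = ⊥-elim (true≢false (∧-intro a (cong not b)) (closed z))
  ... | inj₁ (a , e) with next-crossing P (SmallCut.inv2 p) (∧-fst (P a) e) (not-true (∧-snd (P a) e))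
  ... | b , b≢a , pb , pb′ , _ = inj₁ record
    { inv0 = inv0 ; inv2 = inv2 ; c₁ = a ; c₂ = b ; c₁≢c₂ = ≢-sym b≢a
    ; in₁ = pa ; out₁ = pa′ ; in₂ = pb ; out₂ = pb′
    ; only = λ z pz pz′ → three (only a pa pa′) (only b pb pb′) (only z pz pz′) }
    where
    open SmallCut p
    pa = ∧-fst (P a) e
    pa′ = not-true (∧-snd (P a) e)
    three : ∀ {z} → a ≡ u ⊎ a ≡ w → b ≡ u ⊎ b ≡ w → z ≡ u ⊎ z ≡ w → z ≡ a ⊎ z ≡ b
    three (inj₁ refl) _ (inj₁ e) = inj₁ e
    three (inj₂ refl) _ (inj₂ e) = inj₁ e
    three _ (inj₁ refl) (inj₁ e) = inj₂ e
    three _ (inj₂ refl) (inj₂ e) = inj₂ e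
    three (inj₁ refl) (inj₁ refl) (inj₂ _) = ⊥-elim (b≢a refl)
    three (inj₂ refl) (inj₂ refl) (inj₁ _) = ⊥-elim (b≢a refl)

  data JoinSpan (A : Subset n) : Set where
    none : (∀ x → A x ≡ false) → JoinSpan A
    add  : {P B : Subset n} → TwoCut P → JoinSpan B → (∀ x → A x ≡ P x xor B x) → JoinSpan A

  join-≗ : {A B : Subset n} → (∀ x → A x ≡ B x) → JoinSpan B → JoinSpan A
  join-≗ h (none h′) = none (λ x → trans (h x) (h′ x))
  join-≗ h (add p b h′) = add p b (λ x → trans (h x) (h′ x))

  module _ (constant : ∀ P → Invariant P t0 → Invariant P t2 → Invariant P s → (∀ x → P x ≡ false) ⊎ (∀ x → P x ≡ true)) where

    -- In a connected graph a small cut without crossings is empty or everything. Dropping an empty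
    -- one changes nothing; dropping a full one complements the sum, hence the two alternatives.
    span⇒join : {A : Subset n} → Span s A → JoinSpan A ⊎ JoinSpan (not ∘ A)
    span⇒join (none h) = inj₁ (none h)
    span⇒join {A} (add {P} {B} p b h) with small⇒two p | span⇒join b
    ... | inj₁ q | inj₁ j = inj₁ (add q j h)
    ... | inj₁ q | inj₂ j = inj₂ (add q j (λ x → trans (cong not (h x)) (sym (xor-not (P x) (B x)))))
      where
      xor-not : ∀ a b → a xor not b ≡ not (a xor b)
      xor-not true b = refl
      xor-not false b = refl
    ... | inj₂ Ps | j with constant P (SmallCut.inv0 p) (SmallCut.inv2 p) Ps | j
    ...   | inj₁ f | inj₁ j′ = inj₁ (join-≗ (λ x → trans (h x) (cong (_xor B x) (f x))) j′)
    ...   | inj₁ f | inj₂ j′ = inj₂ (join-≗ (λ x → cong not (trans (h x) (cong (_xor B x) (f x)))) j′)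
    ...   | inj₂ f | inj₁ j′ = inj₂ (join-≗ (λ x → trans (cong not (trans (h x) (cong (_xor B x) (f x)))) (not-involutive (B x))) j′)
    ...   | inj₂ f | inj₂ j′ = inj₁ (join-≗ (λ x → trans (h x) (cong (_xor B x) (f x))) j′)

    -- A complement can be absorbed into the first two-crossing set, whose complement again has two
    -- crossings. Only the empty sum has nothing to absorb it; then `A` is everything, and this is
    -- where the geometric dual enters the relation.
    span⇒join-or-full : {A : Subset n} → Span s A → JoinSpan A ⊎ (∀ x → A x ≡ true)
    span⇒join-or-full {A} a with span⇒join a
    ... | inj₁ j = inj₁ j
    ... | inj₂ (none h) = inj₂ (λ x → trans (sym (not-involutive (A x))) (cong not (h x)))
    ... | inj₂ (add {P} {B} q j h) = inj₁ (add (TwoCut-not q) j λ x → absorb (A x) (P x) (B x) (h x))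
      where
      absorb : ∀ a p b → not a ≡ p xor b → a ≡ not p xor b
      absorb true true true _ = refl
      absorb true false false _ = refl
      absorb false true false _ = refl
      absorb false false true _ = refl

module JoinOf (G : RG) (G-rg : IsRG G) (conn : ∀ x y → SameComponent G x y) where
  open Orbits G G-rg using (T1; T2)
  open Joins (t0 G) (t2 G) (t1 G) T2 T1

  constant : ∀ P → Invariant P (t0 G) → Invariant P (t2 G) → Invariant P (t1 G) →
    (∀ x → P x ≡ false) ⊎ (∀ x → P x ≡ true)
  constant P P0 P2 P1 with decide P
  ... | inj₂ empty = inj₁ empty
  ... | inj₁ (x , e) = inj₂ (λ y → trans (sym (walk (conn x y))) e)
    where
    walk : ∀ {x y} → SameComponent G x y → P x ≡ P y
    walk ε = refl
    walk (inj₁ refl ◅ r) = trans (sym (P0 _)) (walk r)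
    walk (inj₂ (inj₁ refl) ◅ r) = trans (sym (P1 _)) (walk r)
    walk (inj₂ (inj₂ refl) ◅ r) = trans (sym (P2 _)) (walk r)

  vertex-equiv : IsEquivalence (SameVertex G)
  vertex-equiv = Star-equiv λ { (inj₁ e) → inj₁ (flip-involution T1 e) ; (inj₂ e) → inj₂ (flip-involution T2 e) }

  same-vertex : {P : Subset (RG.n G)} (p : TwoCut P) → SameVertex G (TwoCut.c₁ p) (TwoCut.c₂ p)
  same-vertex {P} p with next-crossing P inv2 in₁ out₁
    where open TwoCut p
  ... | b , b≢ , pb , pb′ , r with TwoCut.only p b pb pb′
  ... | inj₁ e = ⊥-elim (b≢ e)
  ... | inj₂ refl = gen-elim _ vertex-equiv ((λ z → inj₂ refl ◅ ε) ∷ step ∷ []) r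
    where
    X = Crossings.X P (t1 G) T1
    step : ∀ z → SameVertex G z (off (t1 G) X z)
    step z with true? (X z)
    ... | inj₁ e = subst (SameVertex G z) (sym (mix-true X e)) ε
    ... | inj₂ e = inj₁ (mix-false X e) ◅ ε

  -- A path in G leaves the side only through `e₁` or `e₂` and comes back through one of them. As
  -- both lie at one vertex, the excursion is replaced by a step at that vertex.
  connected-side : {P : Subset (RG.n G)} (p : TwoCut P) (b : Bool) (e₁ e₂ : Fin (RG.n G)) → SameVertex G e₁ e₂ →
    P e₁ ≡ b → P e₂ ≡ b → (∀ z → P z ≡ b → P (t1 G z) ≢ b → z ≡ e₁ ⊎ z ≡ e₂) →
    ∀ x y → P x ≡ b → P y ≡ b → Star (SubStep G P b) x y
  connected-side {P} p b e₁ e₂ e₁₂ pe₁ pe₂ exits x y px py = inside (conn x y) px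
    where
    open TwoCut p
    Path = Star (SubStep G P b)
    to₁ : ∀ {z} → z ≡ e₁ ⊎ z ≡ e₂ → Path z e₁
    to₁ (inj₁ refl) = ε
    to₁ (inj₂ refl) = (pe₂ , pe₁ , inj₂ (IsEquivalence.sym vertex-equiv e₁₂)) ◅ ε
    from₁ : ∀ {z} → z ≡ e₁ ⊎ z ≡ e₂ → Path e₁ z
    from₁ (inj₁ refl) = ε
    from₁ (inj₂ refl) = (pe₁ , pe₂ , inj₂ e₁₂) ◅ ε
    inside : ∀ {x} → SameComponent G x y → P x ≡ b → Path x y
    outside : ∀ {x} → SameComponent G x y → P x ≢ b → Path e₁ y
    inside ε px = ε
    inside {x} (inj₁ refl ◅ r) px = (px , trans (inv0 x) px , inj₁ (inj₁ refl ◅ ε)) ◅ inside r (trans (inv0 x) px)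
    inside {x} (inj₂ (inj₂ refl) ◅ r) px = (px , trans (inv2 x) px , inj₁ (inj₂ refl ◅ ε)) ◅ inside r (trans (inv2 x) px)
    inside {x} (inj₂ (inj₁ refl) ◅ r) px with P (t1 G x) Bool.≟ b
    ... | yes e = (px , e , inj₂ (inj₁ refl ◅ ε)) ◅ inside r e
    ... | no ne = to₁ (exits x px ne) ◅◅ outside r ne
    outside ε nx = ⊥-elim (nx py)
    outside {x} (inj₁ refl ◅ r) nx = outside r (λ e → nx (trans (sym (inv0 x)) e))
    outside {x} (inj₂ (inj₂ refl) ◅ r) nx = outside r (λ e → nx (trans (sym (inv2 x)) e))
    outside {x} (inj₂ (inj₁ refl) ◅ r) nx with P (t1 G x) Bool.≟ b
    ... | yes e = from₁ (exits (t1 G x) e (λ e′ → nx (trans (cong P (sym (proj₁ T1 x))) e′))) ◅◅ inside r e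
    ... | no ne = outside r ne

  isJoin : {P : Subset (RG.n G)} → TwoCut P → IsJoin G P
  isJoin {P} p = record
    { edgeSet = inv0 , inv2
    ; pv = c₁ ; qv = t1 G c₁ ; pvP = in₁ ; qvQ = out₁ ; pvqv = inj₁ refl ◅ ε
    ; meet = λ x y px py r → meet px py r
    ; Pconn = connected-side p true c₁ c₂ c₁∼c₂ in₁ in₂ (λ z pz ne → only z pz (¬-not ne))
    ; Qconn = connected-side p false (N.c₁) (N.c₂) (same-vertex (TwoCut-not p)) out₁ out₂
        (λ z pz ne → N.only z (cong not pz) (cong not (≢false ne)))
    ; c₁ = c₁ ; c₂ = c₂ ; c₁≢c₂ = c₁≢c₂
    ; c₁corner = ε , in₁ , out₁
    ; c₂corner = V.sym c₁∼c₂ , in₂ , out₂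
    ; only = λ z (_ , a , b) → only z a b }
    where
    open TwoCut p
    module N = TwoCut (TwoCut-not p)
    module V = IsEquivalence vertex-equiv
    c₁∼c₂ = same-vertex p
    ≢false : {b : Bool} → b ≢ false → b ≡ true
    ≢false {true} _ = refl
    ≢false {false} ne = ⊥-elim (ne refl)
    -- Going round the vertex from a flag of `P` to one outside, the walk crosses the cut, which it
    -- can only do at `c₁` or `c₂`.
    meet : ∀ {x y} → P ∋ x → P y ≡ false → SameVertex G x y → SameVertex G x c₁
    meet px py ε = ⊥-elim (true≢false px py)
    meet px py (inj₂ refl ◅ r) = inj₂ refl ◅ meet (trans (inv2 _) px) py r
    meet {x} px py (inj₁ refl ◅ r) with true? (P (t1 G x))
    ... | inj₁ e = inj₁ refl ◅ meet e py r
    ... | inj₂ e with only x px e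
    ... | inj₁ refl = ε
    ... | inj₂ refl = V.sym c₁∼c₂

-- Composing moves along two-crossing sets

module Chain (G : RG) (G-rg : IsRG G) (conn : ∀ x y → SameComponent G x y) where
  open Orbits G G-rg using (T1; T2)
  open Joins (t0 G) (t2 G) (t1 G) T2 T1

  -- Having two crossings refers to t1 only, so a cut of G is a cut of all partial duals of G.
  module _ (C : Subset (RG.n G)) (C-edges : IsEdgeSet G C) where
    G′ = partialDual G C
    open PartialDual G G-rg C C-edges using (partialDual-rg; connected)
    module O′ = Orbits G′ partialDual-rg
    module J′ = Joins (t0 G′) (t2 G′) (t1 G) O′.T2 T1

    cut-of-dual : {P : Subset (RG.n G)} → TwoCut P → J′.TwoCut P
    cut-of-dual {P} p = record
      { inv0 = λ z → either (C z) (inv2 z) (inv0 z) ; inv2 = λ z → either (C z) (inv0 z) (inv2 z)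
      ; c₁ = c₁ ; c₂ = c₂ ; c₁≢c₂ = c₁≢c₂ ; in₁ = in₁ ; out₁ = out₁ ; in₂ = in₂ ; out₂ = out₂ ; only = only }
      where
      open TwoCut p
      either : ∀ b {x y z} → P x ≡ P z → P y ≡ P z → P (if b then x else y) ≡ P z
      either true e _ = e
      either false _ e = e

    move : {P D : Subset (RG.n G)} → TwoCut P → (∀ x → D x ≡ C x xor P x) → Move G′ (partialDual G D)
    -- The set in a `Move` is the summand that is kept, so dualling `P` takes its complement as that
    -- set.
    move {P} p h = not ∘ P , JoinOf.isJoin G′ partialDual-rg (connected conn) (cut-of-dual (TwoCut-not p))
      , partialDual-twice G {C} (λ x → trans (h x) (cong (C x xor_) (sym (not-involutive (P x)))))

  -- `C` collects the edges dualled so far. Every intermediate graph is written as a partial dual of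
  -- the one G, on the same flags, so the remaining cuts apply to it as they stand.
  chain : {A : Subset (RG.n G)} → JoinSpan A → ∀ C → IsEdgeSet G C → {D : Subset (RG.n G)} → (∀ x → D x ≡ C x xor A x) →
    Σ RG λ K → Star Move (partialDual G C) K × (K ≅ partialDual G D)
  chain (none h) C eC h′ = partialDual G C , ε , partialDual-cong G λ x →
    sym (trans (h′ x) (trans (cong (C x xor_) (h x)) (xor-identityʳ (C x))))
  chain (add {P} {B} p b h) C (C0 , C2) h′
    with chain b (λ x → C x xor P x)
           ((λ x → cong₂ _xor_ (C0 x) (TwoCut.inv0 p x)) , (λ x → cong₂ _xor_ (C2 x) (TwoCut.inv2 p x)))
           (λ x → trans (h′ x) (trans (cong (C x xor_) (h x)) (sym (xor-assoc (C x) (P x) (B x)))))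
  ... | K , ms , φ = K , move C (C0 , C2) p (λ _ → refl) ◅ ms , φ

-- From partial duals to moves, for the plane and the projective plane together

connected⇒same : (G : RG) → Connected G → ∀ x y → SameComponent G x y
connected⇒same G (suc zero , (f , _ , eq) , _) x y = proj₁ (eq x y) (only-one (f x) (f y))
  where
  only-one : (i j : Fin 1) → i ≡ j
  only-one zero zero = refl
connected⇒same G (zero , (f , _) , _) x y with f x
... | ()
connected⇒same G (suc (suc c) , _ , ()) x y

-- Both surfaces are covered by `g ≤ 1`. The genus of `H` enters through the isomorphism `φ`, as the
-- genus of G^A.
partialDuals⇒related : (G H : RG) → IsRG G → Connected G → {g : ℕ} → g ≤ 1 → EulerGenus G g → EulerGenus H g →
  PartialDuals G H → RelatedByDuallingJoinSummands G H
partialDuals⇒related G H G-rg G-conn g≤1 γG γH (A , A-edges , φ) = finish (JS.span⇒join-or-full constant (span (inhabited? (RG.n G))))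
  where
  conn = connected⇒same G G-conn
  open Orbits G G-rg using (T1; T2; edgePair; low)
  open Spans (t0 G) (t2 G) using (Span; none)
  module JS = Joins (t0 G) (t2 G) (t1 G) T2 T1
  open JoinOf G G-rg conn using (constant)
  open PartialDual G G-rg A A-edges using (low′)
  open Main (t0 G) (t2 G) edgePair A (proj₁ A-edges) (proj₂ A-edges) using (main)
  inhabited? : (m : ℕ) → Fin m ⊎ (Fin m → ⊥)
  inhabited? zero = inj₂ λ ()
  inhabited? (suc m) = inj₁ zero
  span : Fin (RG.n G) ⊎ (Fin (RG.n G) → ⊥) → Span (t1 G) A
  span (inj₁ o) = main o _ (t1 G) T1 (low g≤1 γG) (low′ g≤1 (EulerGenus-≅ φ γH)) ≤-refl
  -- `main` needs a flag to start from; a graph without flags has only the empty edge set.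
  span (inj₂ no-flag) = none (λ x → ⊥-elim (no-flag x))
  finish : JS.JoinSpan A ⊎ (∀ x → A x ≡ true) → RelatedByDuallingJoinSummands G H
  finish (inj₁ j) with Chain.chain G G-rg conn j (const false) ((λ _ → refl) , (λ _ → refl)) (λ _ → refl)
  ... | K , ms , ψ = inj₁ (K , ms , ≅-trans ψ φ)
  finish (inj₂ full) = inj₂ (≅-trans (partialDual-cong G (λ x → sym (full x))) φ)

theorem5 : (G H : RG) → IsRG G → IsRG H → Connected G → Connected H →
    ((Plane G → Plane H → (PartialDuals G H ⇔ RelatedByDuallingJoinSummands G H))
    × (RP2 G → RP2 H → (PartialDuals G H ⇔ RelatedByDuallingJoinSummands G H)))
theorem5 G H G-rg _ G-conn _ =
    (λ (_ , γG) (_ , γH) → mk⇔ (partialDuals⇒related G H G-rg G-conn z≤n γG γH) related⇒partialDuals)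
  , (λ (_ , γG) (_ , γH) → mk⇔ (partialDuals⇒related G H G-rg G-conn ≤-refl γG γH) related⇒partialDuals)
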